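{- Let $d$ be a nonnegative integer and let $$H_1(x)=\sum_{i=1}^k \alpha_i (x+x_i)^d,$$ where $x_1,\ldots,x_k$ are distinct real constants, the $\alpha_i$ are nonzero real constants, and $k \leq (d+2)/4$. If $H_1$ is written in the form $$H_1(x)=\sum_{i=1}^l \beta_i (x+y_i)^{e_i}$$ with real constants $\beta_i,y_i$ and nonnegative integers $e_i \leq d$ for every $i$, then $l \geq k$. -}

module Defs where

open import Level using (Level; _⊔_) renaming (suc to lsuc)
open import Algebra.Bundles using (CommutativeRing)
open import Data.Nat using (ℕ; zero; suc)
open import Data.Fin using (Fin) renaming (zero to fzero; suc to fsuc)
open import Data.Product using (Σ; ∃; _×_)
open import Data.Sum using (_⊎_)
open import Relation.Nullary using (¬_)

-- A (Dedekind-)complete ordered field: the axiomatic description of ℝ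
-- (any model is isomorphic to the real numbers, classically).
record CompleteOrderedField (c ℓ : Level) : Set (lsuc (c ⊔ ℓ)) where
  field
    commRing : CommutativeRing c ℓ
  open CommutativeRing commRing public
  field
    _≤_        : Carrier → Carrier → Set ℓ
    0≉1        : ¬ (0# ≈ 1#)
    inverse    : ∀ x → ¬ (x ≈ 0#) → ∃ λ y → x * y ≈ 1#
    ≤-resp-≈   : ∀ {x x′ y y′} → x ≈ x′ → y ≈ y′ → x ≤ y → x′ ≤ y′
    ≤-refl     : ∀ {x} → x ≤ x
    ≤-trans    : ∀ {x y z} → x ≤ y → y ≤ z → x ≤ z
    ≤-antisym  : ∀ {x y} → x ≤ y → y ≤ x → x ≈ y
    ≤-total    : ∀ x y → x ≤ y ⊎ y ≤ x
    +-mono-≤   : ∀ {x y} z → x ≤ y → (x + z) ≤ (y + z)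
    *-nonneg   : ∀ {x y} → 0# ≤ x → 0# ≤ y → 0# ≤ (x * y)
    sup        : (P : Carrier → Set (c ⊔ ℓ)) → (∃ λ x → P x) →
                 (∃ λ b → ∀ x → P x → x ≤ b) →
                 ∃ λ s → (∀ x → P x → x ≤ s) × (∀ b → (∀ x → P x → x ≤ b) → s ≤ b)

module _ {c ℓ} (R : CompleteOrderedField c ℓ) where
  open CompleteOrderedField R

  pow : Carrier → ℕ → Carrier
  pow x zero    = 1#
  pow x (suc n) = x * pow x n

  ∑ : (n : ℕ) → (Fin n → Carrier) → Carrier
  ∑ zero    f = 0#
  ∑ (suc n) f = f fzero + ∑ n (λ i → f (fsuc i))

{-# OPTIONS --safe #-}
module Submission where

-- Suppose l < k. Moving everything to one side gives k + l terms with Σ a (x + z)ᵉ = 0, and replacing each power by the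
-- truncated power (x + z)₊ᵉ gives a spline S that vanishes far to the left and far to the right. Let N_t be the number
-- of alternating rises and falls of its t-th derivative. If J_t terms jump at that level, then deleting the jumps costs at
-- most 2 J_t of them, the mean value theorem turns the others into alternating signs of the next derivative, and compact
-- support makes one more rise or fall out of these: N_t ≤ N_{t+1} + 2 J_t - 1. Since l < k, some x_i differs from
-- all y_j, so every derivative up to the d-th is nonzero and N_0 ≥ 2. Summing up, d + 2 ≤ 2 (k + l) ≤ 4k - 2, against
-- 4k ≤ d + 2.

open import Defs
open import Data.Nat using (ℕ) renaming (_≤_ to _≤ℕ_; _+_ to _+ℕ_; _*_ to _*ℕ_)
open import Data.Fin using (Fin)
open import Relation.Binary.PropositionalEquality using (_≡_)
open import Relation.Nullary using (¬_)

import Data.Fin as Fin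
import Data.Fin.Properties as Fin
import Data.Integer as ℤ
import Data.Integer.Properties as ℤ
import Data.List.Properties as List
import Data.List.Relation.Unary.All as All
import Data.List.Relation.Unary.All.Properties as All
import Data.Nat as ℕ
import Data.Nat.Properties as ℕ
import Data.Nat.Solver
import Relation.Binary.PropositionalEquality as ≡
import Relation.Binary.Reasoning.Setoid as SetoidReasoning
open import Algebra.Solver.Ring.AlmostCommutativeRing using (fromCommutativeRing; _-Raw-AlmostCommutative⟶_)
open import Data.Empty using (⊥-elim)
open import Data.List using (List; []; _∷_; _++_; length; tabulate)
open import Data.List.Relation.Unary.All using (All; []; _∷_)
open import Data.Maybe using (Maybe; just; nothing)
open import Data.Product using (∃; _×_; _,_; proj₁; proj₂)
open import Data.Sum using (_⊎_; inj₁; inj₂; [_,_]′)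
open import Level using (Lift; lift; lower; _⊔_)
open import Relation.Nullary using (Dec; yes; no; contradiction; ¬?)
open import Relation.Nullary.Decidable using (decidable-stable)

-- Rises and falls are counted, rather than zeros or sign changes, because a rise over an interval
-- is unaffected by deleting a step function whose jump lies elsewhere, whereas the sign at a point
-- depends on every term. The obstacle is regularity: terms of exponent 1 leave kinks after the
-- jumps are gone, so there is no two-sided derivative. A right derivative at every point together
-- with left continuity in Lipschitz form suffices for the mean value theorem, and truncated powers
-- are taken right-continuous so that the formal derivative is the right derivative at the knots
-- too. A term with exponent e jumps at level e only, so the J_t add up to the number of terms. The
-- -1 is gained once for each of the d passages to the next derivative, and at level d only steps
-- remain, whence N_d ≤ 2 J_d. If deleting the jumps leaves no rise or fall at all, the gain has to
-- come from elsewhere: the next derivative is known to be nonzero somewhere.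

module ℕIdentities where
  open Data.Nat.Solver.+-*-Solver

  +-2-move : ∀ m t → m ℕ.+ 2 ℕ.+ t ≡ 2 ℕ.+ (m ℕ.+ t)
  +-2-move = solve 2 (λ m t → m :+ con 2 :+ t := con 2 :+ (m :+ t)) ≡.refl

  +-2*suc : ∀ k t → k ℕ.+ 2 ℕ.* ℕ.suc t ≡ 2 ℕ.+ (k ℕ.+ 2 ℕ.* t)
  +-2*suc = solve 2 (λ k t → k :+ con 2 :* (con 1 :+ t) := con 2 :+ (k :+ con 2 :* t)) ≡.refl

  exchange : ∀ n d k l → n ℕ.+ ℕ.suc d ℕ.+ (k ℕ.+ l) ≡ (n ℕ.+ l) ℕ.+ (ℕ.suc k ℕ.+ d)
  exchange = solve 4 (λ n d k l → n :+ (con 1 :+ d) :+ (k :+ l) := (n :+ l) :+ (con 1 :+ k :+ d)) ≡.refl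

  rotate : ∀ k l l′ → k ℕ.+ l ℕ.+ l′ ≡ l ℕ.+ (k ℕ.+ l′)
  rotate = solve 3 (λ k l l′ → k :+ l :+ l′ := l :+ (k :+ l′)) ≡.refl

  2+2*suc-double : ∀ k → 2 ℕ.+ 2 ℕ.* ℕ.suc (k ℕ.+ k) ≡ 4 ℕ.* ℕ.suc k
  2+2*suc-double = solve 1 (λ k → con 2 :+ con 2 :* (con 1 :+ (k :+ k)) := con 4 :* (con 1 :+ k)) ≡.refl

-- Integer coefficients for the ring solver.

module IntegerCoefficients {c ℓ} (ℝ : CompleteOrderedField c ℓ) where
  open CompleteOrderedField ℝ
  open import Algebra.Properties.Semiring.Mult.TCOptimised semiring using (×-homo-+; ×1-homo-*; 1+×) renaming (_×_ to _·_)
  open import Algebra.Properties.Ring ring using (-‿distribˡ-*; -‿distribʳ-*; -‿involutive; -0#≈0#; -‿+-comm)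
  open SetoidReasoning setoid

  -- The canonical homomorphism from ℤ. The solver compares coefficients in order to cancel terms,
  -- and equality is decidable in ℤ but not yet in the field.
  ⟦_⟧ : ℤ.ℤ → Carrier
  ⟦ ℤ.+ n ⟧      = n · 1#
  ⟦ ℤ.-[1+ n ] ⟧ = - (ℕ.suc n · 1#)

  ⟦⟧-neg : ∀ i → ⟦ ℤ.- i ⟧ ≈ - ⟦ i ⟧
  ⟦⟧-neg (ℤ.+ ℕ.zero)  = sym -0#≈0#
  ⟦⟧-neg ℤ.+[1+ n ]    = refl
  ⟦⟧-neg ℤ.-[1+ n ]    = sym (-‿involutive _)

  ⟦⟧-⊖ : ∀ m n → ⟦ m ℤ.⊖ n ⟧ ≈ m · 1# + - (n · 1#)
  ⟦⟧-⊖ m ℕ.zero = sym (trans (+-congˡ -0#≈0#) (+-identityʳ _))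
  ⟦⟧-⊖ ℕ.zero (ℕ.suc n) = sym (+-identityˡ _)
  ⟦⟧-⊖ (ℕ.suc m) (ℕ.suc n) = begin
    ⟦ ℕ.suc m ℤ.⊖ ℕ.suc n ⟧                       ≡⟨ ≡.cong ⟦_⟧ (ℤ.[1+m]⊖[1+n]≡m⊖n m n) ⟩
    ⟦ m ℤ.⊖ n ⟧                                   ≈⟨ ⟦⟧-⊖ m n ⟩
    m · 1# + - (n · 1#)                           ≈⟨ +-identityˡ _ ⟨
    0# + (m · 1# + - (n · 1#))                    ≈⟨ +-congʳ (-‿inverseʳ 1#) ⟨
    (1# + - 1#) + (m · 1# + - (n · 1#))           ≈⟨ +-assoc _ _ _ ⟩
    1# + (- 1# + (m · 1# + - (n · 1#)))           ≈⟨ +-congˡ (+-assoc _ _ _) ⟨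
    1# + ((- 1# + m · 1#) + - (n · 1#))           ≈⟨ +-congˡ (+-congʳ (+-comm _ _)) ⟩
    1# + ((m · 1# + - 1#) + - (n · 1#))           ≈⟨ +-congˡ (+-assoc _ _ _) ⟩
    1# + (m · 1# + (- 1# + - (n · 1#)))           ≈⟨ +-assoc _ _ _ ⟨
    (1# + m · 1#) + (- 1# + - (n · 1#))           ≈⟨ +-cong (sym (1+× m 1#)) (-‿+-comm _ _) ⟩
    ℕ.suc m · 1# + - (1# + n · 1#)                ≈⟨ +-congˡ (-‿cong (1+× n 1#)) ⟨
    ℕ.suc m · 1# + - (ℕ.suc n · 1#)               ∎

  ⟦⟧-+ : ∀ i j → ⟦ i ℤ.+ j ⟧ ≈ ⟦ i ⟧ + ⟦ j ⟧
  ⟦⟧-+ (ℤ.+ m)    (ℤ.+ n)    = ×-homo-+ 1# m n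
  ⟦⟧-+ (ℤ.+ m)    ℤ.-[1+ n ] = ⟦⟧-⊖ m (ℕ.suc n)
  ⟦⟧-+ ℤ.-[1+ m ] (ℤ.+ n)    = trans (⟦⟧-⊖ n (ℕ.suc m)) (+-comm _ _)
  ⟦⟧-+ ℤ.-[1+ m ] ℤ.-[1+ n ] = begin
    - (ℕ.suc (ℕ.suc (m ℕ.+ n)) · 1#)       ≡⟨ ≡.cong (λ k → - (ℕ.suc k · 1#)) (≡.sym (ℕ.+-suc m n)) ⟩
    - ((ℕ.suc m ℕ.+ ℕ.suc n) · 1#)         ≈⟨ -‿cong (×-homo-+ 1# (ℕ.suc m) (ℕ.suc n)) ⟩
    - (ℕ.suc m · 1# + ℕ.suc n · 1#)        ≈⟨ -‿+-comm _ _ ⟨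
    - (ℕ.suc m · 1#) + - (ℕ.suc n · 1#)    ∎

  ⟦⟧-*-nonNeg : ∀ i n → ⟦ i ℤ.* (ℤ.+ n) ⟧ ≈ ⟦ i ⟧ * ⟦ ℤ.+ n ⟧
  ⟦⟧-*-nonNeg (ℤ.+ m) n = begin
    ⟦ ℤ.+ m ℤ.* ℤ.+ n ⟧  ≡⟨ ≡.cong ⟦_⟧ (≡.sym (ℤ.pos-* m n)) ⟩
    (m ℕ.* n) · 1#       ≈⟨ ×1-homo-* m n ⟩
    m · 1# * n · 1#      ∎
  ⟦⟧-*-nonNeg ℤ.-[1+ m ] n = begin
    ⟦ ℤ.-[1+ m ] ℤ.* ℤ.+ n ⟧         ≡⟨ ≡.cong ⟦_⟧ (≡.sym (ℤ.neg-distribˡ-* ℤ.+[1+ m ] (ℤ.+ n))) ⟩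
    ⟦ ℤ.- (ℤ.+[1+ m ] ℤ.* ℤ.+ n) ⟧   ≈⟨ ⟦⟧-neg (ℤ.+[1+ m ] ℤ.* ℤ.+ n) ⟩
    - ⟦ ℤ.+[1+ m ] ℤ.* ℤ.+ n ⟧       ≈⟨ -‿cong (⟦⟧-*-nonNeg ℤ.+[1+ m ] n) ⟩
    - (ℕ.suc m · 1# * n · 1#)        ≈⟨ -‿distribˡ-* _ _ ⟩
    - (ℕ.suc m · 1#) * n · 1#        ∎

  ⟦⟧-* : ∀ i j → ⟦ i ℤ.* j ⟧ ≈ ⟦ i ⟧ * ⟦ j ⟧
  ⟦⟧-* i (ℤ.+ n) = ⟦⟧-*-nonNeg i n
  ⟦⟧-* i ℤ.-[1+ n ] = begin
    ⟦ i ℤ.* ℤ.-[1+ n ] ⟧         ≡⟨ ≡.cong ⟦_⟧ (≡.sym (ℤ.neg-distribʳ-* i ℤ.+[1+ n ])) ⟩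
    ⟦ ℤ.- (i ℤ.* ℤ.+[1+ n ]) ⟧   ≈⟨ ⟦⟧-neg (i ℤ.* ℤ.+[1+ n ]) ⟩
    - ⟦ i ℤ.* ℤ.+[1+ n ] ⟧       ≈⟨ -‿cong (⟦⟧-*-nonNeg i (ℕ.suc n)) ⟩
    - (⟦ i ⟧ * ℕ.suc n · 1#)     ≈⟨ -‿distribʳ-* _ _ ⟩
    ⟦ i ⟧ * - (ℕ.suc n · 1#)     ∎

  morphism : ℤ.+-*-rawRing -Raw-AlmostCommutative⟶ fromCommutativeRing commRing
  morphism = record
    { ⟦_⟧    = ⟦_⟧
    ; +-homo = ⟦⟧-+
    ; *-homo = ⟦⟧-*
    ; -‿homo = ⟦⟧-neg
    ; 0-homo = refl
    ; 1-homo = refl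
    }

  coeff≟ : ∀ i j → Maybe (⟦ i ⟧ ≈ ⟦ j ⟧)
  coeff≟ i j with i ℤ.≟ j
  ... | yes i≡j = just (reflexive (≡.cong ⟦_⟧ i≡j))
  ... | no  _   = nothing

  open import Algebra.Solver.Ring ℤ.+-*-rawRing (fromCommutativeRing commRing) morphism
    coeff≟ public using (solve; _:=_; _:+_; _:*_; _:-_; :-_; con)

-- Signs, and decidability of the order from completeness.

module OrderedField {c ℓ} (ℝ : CompleteOrderedField c ℓ) where
  open CompleteOrderedField ℝ public renaming (_≤_ to infix 4 _≤_)
  open IntegerCoefficients ℝ public using (solve; _:=_; _:+_; _:*_; _:-_; :-_; con)

  -- Every inequality is stated as the sign of one expression, so that a ring identity under
  -- `nonNeg-resp` or `pos-resp` proves it. The structure has no strict order; its role is taken by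
  -- the negation of `x ≤ 0#`.
  NonNeg Pos : Carrier → Set ℓ
  NonNeg x = 0# ≤ x
  Pos x = ¬ (x ≤ 0#)

  opaque
    nonNeg-resp : ∀ {x y} → x ≈ y → NonNeg x → NonNeg y
    nonNeg-resp x≈y = ≤-resp-≈ refl x≈y

    pos-resp : ∀ {x y} → x ≈ y → Pos x → Pos y
    pos-resp x≈y px y≤0 = px (≤-resp-≈ (sym x≈y) refl y≤0)

    nonNeg-+ : ∀ {x y} → NonNeg x → NonNeg y → NonNeg (x + y)
    nonNeg-+ {x} {y} 0≤x 0≤y = ≤-trans 0≤y (≤-resp-≈ (+-identityˡ y) refl (+-mono-≤ y 0≤x))

    ≤⇒nonNeg : ∀ {x y} → x ≤ y → NonNeg (y - x)
    ≤⇒nonNeg {x} x≤y = ≤-resp-≈ (-‿inverseʳ x) refl (+-mono-≤ (- x) x≤y)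

    nonNeg⇒≤ : ∀ {x y} → NonNeg (y - x) → x ≤ y
    nonNeg⇒≤ {x} {y} p = ≤-resp-≈ (+-identityˡ x) (solve 2 (λ a b → b :- a :+ a := b) refl x y) (+-mono-≤ x p)

    ≤0⇒nonNeg : ∀ {x} → x ≤ 0# → NonNeg (- x)
    ≤0⇒nonNeg x≤0 = nonNeg-resp (+-identityˡ _) (≤⇒nonNeg x≤0)

    nonNeg⇒≤0 : ∀ {x} → NonNeg (- x) → x ≤ 0#
    nonNeg⇒≤0 p = nonNeg⇒≤ (nonNeg-resp (sym (+-identityˡ _)) p)

    pos⇒nonNeg : ∀ {x} → Pos x → NonNeg x
    pos⇒nonNeg {x} px = [ (λ x≤0 → contradiction x≤0 px) , (λ 0≤x → 0≤x) ]′ (≤-total x 0#)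

    pos-+ : ∀ {x y} → Pos x → NonNeg y → Pos (x + y)
    pos-+ {x} {y} px 0≤y x+y≤0 = px (≤-trans (nonNeg⇒≤ (nonNeg-resp (solve 2 (λ a b → b := (a :+ b) :- a) refl x y) 0≤y)) x+y≤0)

    pos⇒≉0 : ∀ {x} → Pos x → ¬ (x ≈ 0#)
    pos⇒≉0 px x≈0 = px (≤-resp-≈ refl x≈0 ≤-refl)

    nonNeg-square : ∀ x → NonNeg (x * x)
    nonNeg-square x with ≤-total x 0#
    ... | inj₁ x≤0 = nonNeg-resp (solve 1 (λ a → :- a :* :- a := a :* a) refl x) (*-nonneg (≤0⇒nonNeg x≤0) (≤0⇒nonNeg x≤0))
    ... | inj₂ 0≤x = *-nonneg 0≤x 0≤x

    pos-1 : Pos 1#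
    pos-1 1≤0 = 0≉1 (≤-antisym (nonNeg-resp (*-identityˡ 1#) (nonNeg-square 1#)) 1≤0)

    *-cancel-≈0 : ∀ {x y} → ¬ (x ≈ 0#) → x * y ≈ 0# → y ≈ 0#
    *-cancel-≈0 {x} {y} x≉0 xy≈0 with inverse x x≉0
    ... | i , xi≈1 = begin
      y            ≈⟨ *-identityˡ y ⟨
      1# * y       ≈⟨ *-congʳ xi≈1 ⟨
      x * i * y    ≈⟨ solve 3 (λ a b d → a :* b :* d := a :* d :* b) refl x i y ⟩
      x * y * i    ≈⟨ *-congʳ xy≈0 ⟩
      0# * i       ≈⟨ zeroˡ i ⟩
      0#           ∎
      where open SetoidReasoning setoid

    pos-* : ∀ {x y} → Pos x → Pos y → Pos (x * y)
    pos-* px py xy≤0 = pos⇒≉0 py (*-cancel-≈0 (pos⇒≉0 px) (≤-antisym xy≤0 (*-nonneg (pos⇒nonNeg px) (pos⇒nonNeg py))))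

    pos-*-cancel : ∀ {x y} → NonNeg x → Pos (x * y) → Pos y
    pos-*-cancel {x} {y} 0≤x pxy y≤0 =
      pxy (nonNeg⇒≤0 (nonNeg-resp (solve 2 (λ a b → a :* :- b := :- (a :* b)) refl x y) (*-nonneg 0≤x (≤0⇒nonNeg y≤0))))

    nonNeg-*-cancel : ∀ {x y} → Pos x → NonNeg (x * y) → NonNeg y
    nonNeg-*-cancel {x} {y} px 0≤xy with ≤-total y 0#
    ... | inj₂ 0≤y = 0≤y
    ... | inj₁ y≤0 = ≤-resp-≈ refl (sym (*-cancel-≈0 (pos⇒≉0 px) (≤-antisym
      (nonNeg⇒≤0 (nonNeg-resp (solve 2 (λ a b → a :* :- b := :- (a :* b)) refl x y) (*-nonneg (pos⇒nonNeg px) (≤0⇒nonNeg y≤0))))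
      0≤xy))) ≤-refl

    pos-inverse : ∀ {x} → Pos x → ∃ λ y → Pos y × x * y ≈ 1#
    pos-inverse {x} px with inverse x (pos⇒≉0 px)
    ... | y , xy≈1 = y , pos-*-cancel (pos⇒nonNeg px) (pos-resp (sym xy≈1) pos-1) , xy≈1

  -- S = {y | ¬ ¬ (y ≤ 0)} is closed under adding x, so sup S - x is an upper bound of S.
  ≤0-stable : ∀ {x} → ¬ ¬ (x ≤ 0#) → x ≤ 0#
  ≤0-stable {x} ¬¬x≤0 =
    nonNeg⇒≤0 (nonNeg-resp (solve 2 (λ a b → a :- b :- a := :- b) refl s x) (≤⇒nonNeg (least (s - x) shifted)))
    where
    S : Carrier → Set (c ⊔ ℓ)
    S y = Lift c (¬ ¬ (y ≤ 0#))
    bounded : ∀ y → S y → y ≤ 1#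
    bounded y (lift ¬¬y≤0) with ≤-total y 1#
    ... | inj₁ y≤1 = y≤1
    ... | inj₂ 1≤y = ⊥-elim (¬¬y≤0 (λ y≤0 → pos-1 (≤-trans 1≤y y≤0)))
    supremum = sup S (0# , lift (λ ¬0≤0 → ¬0≤0 ≤-refl)) (1# , bounded)
    s = proj₁ supremum
    upper = proj₁ (proj₂ supremum)
    least = proj₂ (proj₂ supremum)
    closed : ∀ {y} → y ≤ 0# → x ≤ 0# → y + x ≤ 0#
    closed {y} y≤0 x≤0 = nonNeg⇒≤0 (nonNeg-resp (solve 2 (λ a b → :- a :+ :- b := :- (a :+ b)) refl y x) (nonNeg-+ (≤0⇒nonNeg y≤0) (≤0⇒nonNeg x≤0)))
    shifted : ∀ y → S y → y ≤ s - x
    shifted y (lift ¬¬y≤0) = nonNeg⇒≤ (nonNeg-resp (solve 3 (λ a b d → d :- (a :+ b) := d :- b :- a) refl y x s)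
      (≤⇒nonNeg (upper (y + x) (lift (λ p → ¬¬y≤0 (λ y≤0 → ¬¬x≤0 (λ x≤0 → p (closed y≤0 x≤0))))))))

  -- Compare the supremum of {0} ∪ {2 | Q} with 1.
  weak-excluded-middle : (Q : Set ℓ) → ¬ Q ⊎ ¬ ¬ Q
  weak-excluded-middle Q with sup (λ y → Lift c (y ≈ 0# ⊎ (y ≈ 1# + 1#) × Q)) (0# , lift (inj₁ refl)) (1# + 1# , bounded)
    where
    0≤2 : 0# ≤ 1# + 1#
    0≤2 = nonNeg-+ (pos⇒nonNeg pos-1) (pos⇒nonNeg pos-1)
    bounded : ∀ y → Lift c (y ≈ 0# ⊎ (y ≈ 1# + 1#) × Q) → y ≤ 1# + 1#
    bounded y (lift (inj₁ y≈0)) = ≤-resp-≈ (sym y≈0) refl 0≤2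
    bounded y (lift (inj₂ (y≈2 , _))) = ≤-resp-≈ (sym y≈2) refl ≤-refl
  ... | s , upper , least with ≤-total s 1#
  ...   | inj₁ s≤1 = inj₁ λ q → pos-1 (nonNeg⇒≤0 (nonNeg-resp
            (solve 0 (con (ℤ.+ 1) :- (con (ℤ.+ 1) :+ con (ℤ.+ 1)) := :- con (ℤ.+ 1)) refl)
            (≤⇒nonNeg (≤-trans (upper (1# + 1#) (lift (inj₂ (refl , q)))) s≤1))))
  ...   | inj₂ 1≤s = inj₂ λ ¬q → pos-1 (≤-trans 1≤s (least 0# λ where
            y (lift (inj₁ y≈0)) → ≤-resp-≈ (sym y≈0) refl ≤-refl
            y (lift (inj₂ (_ , q))) → ⊥-elim (¬q q)))

  opaque
    -- Both consequences of completeness meet here: one chooses between `¬ Q` and `¬ ¬ Q`, the other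
    -- removes the double negation.
    _≤0? : ∀ x → Dec (x ≤ 0#)
    x ≤0? with weak-excluded-middle (x ≤ 0#)
    ... | inj₁ px = no px
    ... | inj₂ ¬px = yes (≤0-stable ¬px)

    nonNeg? : ∀ x → Dec (NonNeg x)
    nonNeg? x with (- x) ≤0?
    ... | yes -x≤0 = yes (nonNeg-resp (solve 1 (λ a → :- :- a := a) refl x) (≤0⇒nonNeg -x≤0))
    ... | no p-x = no λ 0≤x → p-x (nonNeg⇒≤0 (nonNeg-resp (solve 1 (λ a → a := :- :- a) refl x) 0≤x))

    ¬nonNeg⇒pos : ∀ {x} → ¬ NonNeg x → Pos (- x)
    ¬nonNeg⇒pos {x} ¬0≤x -x≤0 = ¬0≤x (nonNeg-resp (solve 1 (λ a → :- :- a := a) refl x) (≤0⇒nonNeg -x≤0))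

    pos⇒¬nonNeg : ∀ {x} → Pos (- x) → ¬ NonNeg x
    pos⇒¬nonNeg {x} p 0≤x = p (nonNeg⇒≤0 (nonNeg-resp (solve 1 (λ a → a := :- :- a) refl x) 0≤x))

    _≈0? : ∀ x → Dec (x ≈ 0#)
    x ≈0? with x ≤0? | nonNeg? x
    ... | yes x≤0 | yes 0≤x = yes (≤-antisym x≤0 0≤x)
    ... | no px   | _       = no (pos⇒≉0 px)
    ... | yes _   | no ¬0≤x = no λ x≈0 → ¬0≤x (≤-resp-≈ refl (sym x≈0) ≤-refl)

    _≟_ : ∀ x y → Dec (x ≈ y)
    x ≟ y with (x - y) ≈0?
    ... | yes x-y≈0 = yes (trans (solve 2 (λ a b → a := a :- b :+ b) refl x y) (trans (+-congʳ x-y≈0) (+-identityˡ y)))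
    ... | no x-y≉0 = no λ x≈y → x-y≉0 (trans (+-congʳ x≈y) (-‿inverseʳ y))

    upper-bound : ∀ x y → ∃ λ z → x ≤ z × y ≤ z
    upper-bound x y = [ (λ x≤y → y , x≤y , ≤-refl) , (λ y≤x → x , ≤-refl , y≤x) ]′ (≤-total x y)

    lower-bound : ∀ x y → ∃ λ z → z ≤ x × z ≤ y
    lower-bound x y = [ (λ x≤y → x , ≤-refl , x≤y) , (λ y≤x → y , y≤x , ≤-refl) ]′ (≤-total x y)

    pos-min : ∀ {x y} → Pos x → Pos y → ∃ λ z → Pos z × z ≤ x × z ≤ y
    pos-min {x} {y} px py = [ (λ x≤y → x , px , ≤-refl , x≤y) , (λ y≤x → y , py , y≤x , ≤-refl) ]′ (≤-total x y)

    ≤-nonNeg-trans : ∀ {x y z} → x ≤ y → NonNeg (x - z) → NonNeg (y - z)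
    ≤-nonNeg-trans x≤y 0≤x-z = ≤⇒nonNeg (≤-trans (nonNeg⇒≤ 0≤x-z) x≤y)

    pos-square : ∀ {x} → ¬ (x ≈ 0#) → Pos (x * x)
    pos-square x≉0 xx≤0 = x≉0 (*-cancel-≈0 x≉0 (≤-antisym xx≤0 (nonNeg-square _)))

-- One-sided calculus with explicit error bounds.

module Calculus {c ℓ} (ℝ : CompleteOrderedField c ℓ) where
  open OrderedField ℝ public

  -- This is `|e| ≤ b`, with the absolute value unfolded into two signs.
  Within : Carrier → Carrier → Set ℓ
  Within e b = NonNeg (b - e) × NonNeg (b + e)

  opaque
    within-resp : ∀ {e e′ b b′} → e ≈ e′ → b ≈ b′ → Within e b → Within e′ b′
    within-resp e≈ b≈ (p , q) = nonNeg-resp (+-cong b≈ (-‿cong e≈)) p , nonNeg-resp (+-cong b≈ e≈) q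

    within-+ : ∀ {e e′ b b′} → Within e b → Within e′ b′ → Within (e + e′) (b + b′)
    within-+ {e} {e′} {b} {b′} (p , q) (p′ , q′) =
      nonNeg-resp (solve 4 (λ e e′ b b′ → (b :- e) :+ (b′ :- e′) := (b :+ b′) :- (e :+ e′)) refl e e′ b b′) (nonNeg-+ p p′) ,
      nonNeg-resp (solve 4 (λ e e′ b b′ → (b :+ e) :+ (b′ :+ e′) := (b :+ b′) :+ (e :+ e′)) refl e e′ b b′) (nonNeg-+ q q′)

    -- Twice `b * b′ ± e * e′` is a sum of products of the nonnegative factors `b ± e` and
    -- `b′ ± e′`, which avoids splitting on the signs of `e` and `e′`.
    within-* : ∀ {e e′ b b′} → Within e b → Within e′ b′ → Within (e * e′) (b * b′)
    within-* {e} {e′} {b} {b′} (p , q) (p′ , q′) =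
      halve (nonNeg-resp (solve 4 (λ e e′ b b′ → (b :- e) :* (b′ :+ e′) :+ (b :+ e) :* (b′ :- e′)
          := (con (ℤ.+ 1) :+ con (ℤ.+ 1)) :* (b :* b′ :- e :* e′)) refl e e′ b b′)
        (nonNeg-+ (*-nonneg p q′) (*-nonneg q p′))) ,
      halve (nonNeg-resp (solve 4 (λ e e′ b b′ → (b :- e) :* (b′ :- e′) :+ (b :+ e) :* (b′ :+ e′)
          := (con (ℤ.+ 1) :+ con (ℤ.+ 1)) :* (b :* b′ :+ e :* e′)) refl e e′ b b′)
        (nonNeg-+ (*-nonneg p p′) (*-nonneg q q′)))
      where
      halve : ∀ {x} → NonNeg ((1# + 1#) * x) → NonNeg x
      halve = nonNeg-*-cancel (pos-+ pos-1 (pos⇒nonNeg pos-1))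

  opaque
    within-nonNeg : ∀ {x} → NonNeg x → Within x x
    within-nonNeg {x} 0≤x = ≤⇒nonNeg ≤-refl , nonNeg-+ 0≤x 0≤x

    within-0 : Within 0# 0#
    within-0 = within-nonNeg ≤-refl

    within-bound : ∀ x → ∃ λ b → NonNeg b × Within x b
    within-bound x with ≤-total x 0#
    ... | inj₂ 0≤x = x , 0≤x , within-nonNeg 0≤x
    ... | inj₁ x≤0 = - x , ≤0⇒nonNeg x≤0 , nonNeg-+ (≤0⇒nonNeg x≤0) (≤0⇒nonNeg x≤0) ,
      nonNeg-resp (sym (-‿inverseˡ x)) ≤-refl

  opaque
    small : ∀ {η} → Pos η → ∀ C → ∃ λ δ → Pos δ × (∀ h → NonNeg h → NonNeg (δ - h) → Pos (η - C * h))
    small {η} pη C with within-bound C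
    ... | A , 0≤A , A-C , _ with pos-inverse (pos-resp (+-comm 1# A) (pos-+ pos-1 0≤A))
    -- The choice is `δ = η / (A + 1)` with `A ≥ |C|`: then `C * h ≤ A * δ`, which falls short of
    -- `η` by `δ` itself.
    ...   | i , pi , eq = η * i , pos-* pη pi , λ h 0≤h h≤δ →
      pos-resp (trans (regroup η A i h C) (+-congʳ (trans (*-congˡ eq) (*-identityʳ η))))
        (pos-+ (pos-+ (pos-* pη pi) (*-nonneg 0≤A h≤δ)) (*-nonneg A-C 0≤h))
      where
      regroup : ∀ e a i h c → e * i + a * (e * i - h) + (a - c) * h ≈ e * ((a + 1#) * i) - c * h
      regroup = solve 5 (λ e a i h c → e :* i :+ a :* (e :* i :- h) :+ (a :- c) :* h := e :* ((a :+ con (ℤ.+ 1)) :* i) :- c :* h) refl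

  -- A quadratic error term replaces the limit: sums and multiples then merely add and scale the
  -- constant `C`.
  RightDeriv : (Carrier → Carrier) → Carrier → Carrier → Set (c ⊔ ℓ)
  RightDeriv g x y = ∃ λ δ → Pos δ × ∃ λ C → ∀ h → NonNeg h → NonNeg (δ - h) →
    Within (g (x + h) - g x - y * h) (C * (h * h))

  LeftLipschitz : (Carrier → Carrier) → Carrier → Set (c ⊔ ℓ)
  LeftLipschitz g x = ∃ λ δ → Pos δ × ∃ λ C → ∀ h → NonNeg h → NonNeg (δ - h) →
    Within (g (x - h) - g x) (C * h)

  opaque
    rightDeriv-resp : ∀ {g x y y′} → y ≈ y′ → RightDeriv g x y → RightDeriv g x y′
    rightDeriv-resp y≈y′ (δ , pδ , C , b) = δ , pδ , C , λ h 0≤h h≤δ →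
      within-resp (+-congˡ (-‿cong (*-congʳ y≈y′))) refl (b h 0≤h h≤δ)

    rightDeriv-zero : ∀ x → RightDeriv (λ _ → 0#) x 0#
    rightDeriv-zero x = 1# , pos-1 , 0# , λ h _ _ →
      within-resp (solve 1 (λ h → con (ℤ.+ 0) := con (ℤ.+ 0) :- con (ℤ.+ 0) :- con (ℤ.+ 0) :* h) refl h) (sym (zeroˡ _)) within-0

    rightDeriv-+ : ∀ {f g x a b} → RightDeriv f x a → RightDeriv g x b → RightDeriv (λ u → f u + g u) x (a + b)
    rightDeriv-+ {f} {g} {x} {a} {b} (δ , pδ , C , p) (δ′ , pδ′ , C′ , p′) with pos-min pδ pδ′
    ... | ε , pε , ε≤δ , ε≤δ′ = ε , pε , C + C′ , λ h 0≤h h≤ε → within-resp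
      (solve 7 (λ fh f gh g a b h → (fh :- f :- a :* h) :+ (gh :- g :- b :* h) := (fh :+ gh) :- (f :+ g) :- (a :+ b) :* h)
        refl (f (x + h)) (f x) (g (x + h)) (g x) a b h)
      (sym (distribʳ _ _ _))
      (within-+ (p h 0≤h (≤-nonNeg-trans ε≤δ h≤ε)) (p′ h 0≤h (≤-nonNeg-trans ε≤δ′ h≤ε)))

    rightDeriv-* : ∀ {g x a} k → RightDeriv g x a → RightDeriv (λ u → k * g u) x (k * a)
    rightDeriv-* {g} {x} {a} k (δ , pδ , C , p) with within-bound k
    ... | A , _ , kA = δ , pδ , A * C , λ h 0≤h h≤δ → within-resp
      (solve 5 (λ k gh g a h → k :* (gh :- g :- a :* h) := k :* gh :- k :* g :- k :* a :* h) refl k (g (x + h)) (g x) a h)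
      (sym (*-assoc _ _ _))
      (within-* kA (p h 0≤h h≤δ))

    rightDeriv-shift : ∀ {g x a} z → (∀ {u v} → u ≈ v → g u ≈ g v) → RightDeriv g (x + z) a → RightDeriv (λ u → g (u + z)) x a
    rightDeriv-shift {g} {x} {a} z g-cong (δ , pδ , C , p) = δ , pδ , C , λ h 0≤h h≤δ → within-resp
      (+-congʳ (+-congʳ (g-cong (solve 3 (λ x z h → x :+ z :+ h := x :+ h :+ z) refl x z h)))) refl (p h 0≤h h≤δ)

    rightDeriv-local : ∀ {f g x a} δ → Pos δ → f x ≈ g x → (∀ h → NonNeg h → NonNeg (δ - h) → f (x + h) ≈ g (x + h)) →
      RightDeriv f x a → RightDeriv g x a
    rightDeriv-local δ pδ fx≈gx f≈g (δ′ , pδ′ , C , p) with pos-min pδ pδ′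
    ... | ε , pε , ε≤δ , ε≤δ′ = ε , pε , C , λ h 0≤h h≤ε → within-resp
      (+-congʳ (+-cong (f≈g h 0≤h (≤-nonNeg-trans ε≤δ h≤ε)) (-‿cong fx≈gx))) refl (p h 0≤h (≤-nonNeg-trans ε≤δ′ h≤ε))

    leftLipschitz-zero : ∀ x → LeftLipschitz (λ _ → 0#) x
    leftLipschitz-zero x = 1# , pos-1 , 0# , λ h _ _ →
      within-resp (solve 0 (con (ℤ.+ 0) := con (ℤ.+ 0) :- con (ℤ.+ 0)) refl) (sym (zeroˡ _)) within-0

    leftLipschitz-+ : ∀ {f g x} → LeftLipschitz f x → LeftLipschitz g x → LeftLipschitz (λ u → f u + g u) x
    leftLipschitz-+ {f} {g} {x} (δ , pδ , C , p) (δ′ , pδ′ , C′ , p′) with pos-min pδ pδ′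
    ... | ε , pε , ε≤δ , ε≤δ′ = ε , pε , C + C′ , λ h 0≤h h≤ε → within-resp
      (solve 4 (λ fh f gh g → (fh :- f) :+ (gh :- g) := (fh :+ gh) :- (f :+ g)) refl (f (x - h)) (f x) (g (x - h)) (g x))
      (sym (distribʳ _ _ _))
      (within-+ (p h 0≤h (≤-nonNeg-trans ε≤δ h≤ε)) (p′ h 0≤h (≤-nonNeg-trans ε≤δ′ h≤ε)))

    leftLipschitz-* : ∀ {g x} k → LeftLipschitz g x → LeftLipschitz (λ u → k * g u) x
    leftLipschitz-* {g} {x} k (δ , pδ , C , p) with within-bound k
    ... | A , _ , kA = δ , pδ , A * C , λ h 0≤h h≤δ → within-resp
      (solve 3 (λ k gh g → k :* (gh :- g) := k :* gh :- k :* g) refl k (g (x - h)) (g x))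
      (sym (*-assoc _ _ _))
      (within-* kA (p h 0≤h h≤δ))

    leftLipschitz-shift : ∀ {g x} z → (∀ {u v} → u ≈ v → g u ≈ g v) → LeftLipschitz g (x + z) → LeftLipschitz (λ u → g (u + z)) x
    leftLipschitz-shift {g} {x} z g-cong (δ , pδ , C , p) = δ , pδ , C , λ h 0≤h h≤δ → within-resp
      (+-congʳ (g-cong (solve 3 (λ x z h → x :+ z :- h := x :- h :+ z) refl x z h))) refl (p h 0≤h h≤δ)

    leftLipschitz-local : ∀ {f g x} δ → Pos δ → f x ≈ g x → (∀ h → NonNeg h → NonNeg (δ - h) → f (x - h) ≈ g (x - h)) →
      LeftLipschitz f x → LeftLipschitz g x
    leftLipschitz-local δ pδ fx≈gx f≈g (δ′ , pδ′ , C , p) with pos-min pδ pδ′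
    ... | ε , pε , ε≤δ , ε≤δ′ = ε , pε , C , λ h 0≤h h≤ε → within-resp
      (+-cong (f≈g h 0≤h (≤-nonNeg-trans ε≤δ h≤ε)) (-‿cong fx≈gx)) refl (p h 0≤h (≤-nonNeg-trans ε≤δ′ h≤ε))

  -- Kinks are allowed. These are the properties the mean value theorem uses: left continuity where
  -- a supremum is attained, and a slope to its right.
  record Smooth (g g′ : Carrier → Carrier) : Set (c ⊔ ℓ) where
    field
      cong          : ∀ {u v} → u ≈ v → g u ≈ g v
      rightDeriv    : ∀ x → RightDeriv g x (g′ x)
      leftLipschitz : ∀ x → LeftLipschitz g x

  opaque
    smooth-* : ∀ {g g′} k → Smooth g g′ → Smooth (λ u → k * g u) (λ u → k * g′ u)
    smooth-* {g} {g′} k s = record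
      { cong          = λ u≈v → *-congˡ (Smooth.cong s u≈v)
      ; rightDeriv    = λ x → rightDeriv-* {g} k (Smooth.rightDeriv s x)
      ; leftLipschitz = λ x → leftLipschitz-* {g} k (Smooth.leftLipschitz s x)
      }

  opaque
    leftLipschitz-above : ∀ {φ s a} → LeftLipschitz φ s → Pos (φ s - a) →
      ∃ λ d → Pos d × (∀ h → NonNeg h → NonNeg (d - h) → Pos (φ (s - h) - a))
    leftLipschitz-above {φ} {s} {a} (δ , pδ , C , lip) above-s with small above-s C
    ... | δ′ , pδ′ , Ch<η with pos-min pδ pδ′
    ...   | d , pd , d≤δ , d≤δ′ = d , pd , λ h 0≤h h≤d → pos-resp
      (solve 4 (λ f fh a r → (f :- a :- r) :+ (r :+ (fh :- f)) := fh :- a) refl (φ s) (φ (s - h)) a (C * h))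
      (pos-+ (Ch<η h 0≤h (≤-nonNeg-trans d≤δ′ h≤d)) (proj₂ (lip h 0≤h (≤-nonNeg-trans d≤δ h≤d))))

  opaque
    -- The derivative bound reads `φ (s + h) ≤ φ s + h * (y + C * h)`, and the bracket is negative
    -- once `C * h` is below `- y`.
    rightDeriv-below : ∀ {φ s y w} → RightDeriv φ s y → Pos (- y) → Pos w →
      ∃ λ h → Pos h × NonNeg (w - h) × NonNeg (φ s - φ (s + h))
    rightDeriv-below {φ} {s} {y} {w} (δ , pδ , C , deriv) y<0 pw with small y<0 C
    ... | δ′ , pδ′ , Ch<-y with pos-min pδ pδ′
    ...   | d , pd , d≤δ , d≤δ′ with pos-min pd pw
    ...     | h , ph , h≤d , h≤w = h , ph , ≤⇒nonNeg h≤w , nonNeg-resp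
      (solve 5 (λ f fh h c y → (c :* (h :* h) :- (fh :- f :- y :* h)) :+ h :* (:- y :- c :* h) := f :- fh) refl (φ s) (φ (s + h)) h C y)
      (nonNeg-+ (proj₁ (deriv h (pos⇒nonNeg ph) (≤⇒nonNeg (≤-trans h≤d d≤δ))))
        (*-nonneg (pos⇒nonNeg ph) (pos⇒nonNeg (Ch<-y h (pos⇒nonNeg ph) (≤⇒nonNeg (≤-trans h≤d d≤δ′))))))

  opaque
    -- The supremum of the points with `φ x ≤ φ u` is one of them: otherwise left continuity keeps
    -- `φ` above `φ u` on some `[s - d, s]`, and `s - d` would be a smaller upper bound.
    last-point-below : ∀ {φ} → (∀ {x y} → x ≈ y → φ x ≈ φ y) → (∀ x → LeftLipschitz φ x) →
      ∀ {u v} → u ≤ v → ∃ λ s → u ≤ s × s ≤ v × NonNeg (φ u - φ s) ×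
        (∀ x → u ≤ x → x ≤ v → NonNeg (φ u - φ x) → x ≤ s)
    last-point-below {φ} φ-cong lip {u} {v} u≤v
      with sup (λ x → Lift c (u ≤ x × x ≤ v × NonNeg (φ u - φ x))) (u , lift (≤-refl , u≤v , ≤⇒nonNeg ≤-refl))
               (v , λ x p → proj₁ (proj₂ (lower p)))
    ... | s , upper , least =
      s , upper u (lift (≤-refl , u≤v , ≤⇒nonNeg ≤-refl)) , least v (λ x p → proj₁ (proj₂ (lower p))) , below ,
      λ x u≤x x≤v φx≤φu → upper x (lift (u≤x , x≤v , φx≤φu))
      where
      swap : ∀ {a b} → ¬ NonNeg (a - b) → Pos (b - a)
      swap {a} {b} n = pos-resp (solve 2 (λ a b → :- (a :- b) := b :- a) refl a b) (¬nonNeg⇒pos n)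
      unswap : ∀ {a b} → Pos (b - a) → ¬ NonNeg (a - b)
      unswap {a} {b} p = pos⇒¬nonNeg (pos-resp (solve 2 (λ a b → b :- a := :- (a :- b)) refl a b) p)
      below : NonNeg (φ u - φ s)
      below with nonNeg? (φ u - φ s)
      ... | yes p = p
      ... | no ¬p with leftLipschitz-above {φ} (lip s) (swap ¬p)
      ...   | d , pd , above = contradiction
        (least (s - d) λ where
          x (lift (u≤x , x≤v , φx≤φu)) → [ (λ x≤ → x≤) , (λ s-d≤x → contradiction φx≤φu (unswap (pos-resp
            (+-congʳ (φ-cong (solve 2 (λ s x → s :- (s :- x) := x) refl s x)))
            (above (s - x) (≤⇒nonNeg (upper x (lift (u≤x , x≤v , φx≤φu))))
              (nonNeg-resp (solve 3 (λ s x d → x :- (s :- d) := d :- (s :- x)) refl s x d) (≤⇒nonNeg s-d≤x)))))) ]′ (≤-total x (s - d)))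
        (λ s≤s-d → pd (nonNeg⇒≤0 (nonNeg-resp (solve 2 (λ a b → a :- b :- a := :- b) refl s d) (≤⇒nonNeg s≤s-d))))

  opaque
    x≤x+h : ∀ {x h} → Pos h → x ≤ x + h
    x≤x+h {x} {h} ph = nonNeg⇒≤ (nonNeg-resp (solve 2 (λ s h → h := s :+ h :- s) refl x h) (pos⇒nonNeg ph))

  opaque
    smooth-tilt : ∀ {g g′} → Smooth g g′ → ∀ ε → Smooth (λ x → g x + - ε * x) (λ x → g′ x + - ε)
    smooth-tilt {g} {g′} smooth ε = record
      { cong = λ u≈v → +-cong (Smooth.cong smooth u≈v) (*-congˡ u≈v)
      ; rightDeriv = λ x → rightDeriv-+ {g} {λ u → - ε * u} (Smooth.rightDeriv smooth x) (1# , pos-1 , 0# , λ h _ _ →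
          within-resp (solve 3 (λ e x h → con (ℤ.+ 0) := :- e :* (x :+ h) :- :- e :* x :- :- e :* h) refl ε x h) (sym (zeroˡ _)) within-0)
      ; leftLipschitz = λ x → leftLipschitz-+ {g} {λ u → - ε * u} (Smooth.leftLipschitz smooth x) (tilt x)
      }
      where
      tilt : ∀ x → LeftLipschitz (λ u → - ε * u) x
      tilt x with within-bound ε
      ... | A , _ , εA = 1# , pos-1 , A , λ h 0≤h _ → within-resp
        (solve 3 (λ e x h → e :* h := :- e :* (x :- h) :- :- e :* x) refl ε x h) refl (within-* εA (within-nonNeg 0≤h))

  opaque
    -- For a small slope ε, the last point s of [u, v] where φ s ≤ φ u, with φ x = g x - ε x, has φ′ s ≥ 0, so g′ s ≥ ε.
    mean-value : ∀ {g g′} → Smooth g g′ → ∀ {u v} → u ≤ v → Pos (g v - g u) → ∃ λ s → u ≤ s × s ≤ v × Pos (g′ s)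
    mean-value {g} {g′} smooth {u} {v} u≤v rise with small rise (v - u)
    ... | ε , pε , εh<Δ with last-point-below {λ x → g x + - ε * x} (Smooth.cong (smooth-tilt smooth ε)) (Smooth.leftLipschitz (smooth-tilt smooth ε)) u≤v
    ...   | s , u≤s , s≤v , φs≤φu , last = s , u≤s , s≤v , g′s-pos
      where
      φ : Carrier → Carrier
      φ x = g x + - ε * x
      φ-cong : ∀ {x y} → x ≈ y → φ x ≈ φ y
      φ-cong = Smooth.cong (smooth-tilt smooth ε)
      -- At `v` the tilted function still exceeds `φ u`, since `ε * (v - u)` is less than the rise
      -- of `g`. So `s` is not `v`, and there is room to its right.
      s<v : Pos (v - s)
      s<v v-s≤0 = pos⇒¬nonNeg
        (pos-resp (solve 5 (λ gv gu e v u → (gv :- gu) :- (v :- u) :* e := :- (gu :+ :- e :* u :- (gv :+ :- e :* v))) refl (g v) (g u) ε v u)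
          (εh<Δ ε (pos⇒nonNeg pε) (≤⇒nonNeg ≤-refl)))
        (nonNeg-resp (+-congˡ (-‿cong (φ-cong (≤-antisym s≤v v≤s)))) φs≤φu)
        where
        v≤s : v ≤ s
        v≤s = nonNeg⇒≤ (nonNeg-resp (solve 2 (λ a b → :- (a :- b) := b :- a) refl v s) (≤0⇒nonNeg v-s≤0))
      g′s-pos : Pos (g′ s)
      g′s-pos g′s≤0 with rightDeriv-below {λ x → g x + - ε * x} (Smooth.rightDeriv (smooth-tilt smooth ε) s)
        (pos-resp (solve 2 (λ e d → e :+ :- d := :- (d :+ :- e)) refl ε (g′ s)) (pos-+ pε (≤0⇒nonNeg g′s≤0))) s<v
      ... | h , ph , h≤v-s , φ-low = ph (nonNeg⇒≤0 (nonNeg-resp (solve 2 (λ s h → s :- (s :+ h) := :- h) refl s h)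
        (≤⇒nonNeg (last (s + h) (≤-trans u≤s (x≤x+h ph))
          (nonNeg⇒≤ (nonNeg-resp (solve 3 (λ s h v → v :- s :- h := v :- (s :+ h)) refl s h v) h≤v-s))
          (nonNeg-resp (solve 3 (λ a b d → a :- b :+ (b :- d) := a :- d) refl (φ u) (φ s) (φ (s + h))) (nonNeg-+ φs≤φu φ-low))))))

  opaque
    -- Zeros at both `x` and `x + h` would give `|y| * h ≤ C * (h * h)`. Multiplying by `y`, with
    -- `A ≥ |y|`, turns this into `y * y ≤ C * A * h` whatever the sign of `y`, and a small `h`
    -- violates it.
    nonzero-deriv⇒nonzero : ∀ {g x y} → RightDeriv g x y → ¬ (y ≈ 0#) → ∃ λ w → x ≤ w × ¬ (g w ≈ 0#)
    nonzero-deriv⇒nonzero {g} {x} {y} (δ , pδ , C , deriv) y≉0 with g x ≈0?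
    ... | no gx≉0 = x , ≤-refl , gx≉0
    ... | yes gx≈0 with within-bound y
    ...   | A , _ , yA with small (pos-square y≉0) (C * A)
    ...     | δ′ , pδ′ , Ch<y with pos-min pδ pδ′
    ...       | h , ph , h≤δ , h≤δ′ = x + h , x≤x+h ph , λ gxh≈0 → pos⇒¬nonNeg
      (pos-resp (solve 4 (λ y c a h → h :* (y :* y :- c :* a :* h) := :- (c :* (h :* h) :* a :+ (con (ℤ.+ 0) :- con (ℤ.+ 0) :- y :* h) :* y)) refl y C A h)
        (pos-* ph (Ch<y h (pos⇒nonNeg ph) (≤⇒nonNeg h≤δ′))))
      (nonNeg-resp (+-congˡ (*-congʳ (+-congʳ (+-cong gxh≈0 (-‿cong gx≈0)))))
        (proj₂ (within-* (deriv h (pos⇒nonNeg ph) (≤⇒nonNeg h≤δ)) yA)))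

-- Powers and truncated powers.

module TruncatedPowers {c ℓ} (ℝ : CompleteOrderedField c ℓ) where
  open Calculus ℝ public

  fromℕ : ℕ → Carrier
  fromℕ ℕ.zero    = 0#
  fromℕ (ℕ.suc n) = 1# + fromℕ n

  opaque
    nonNeg-fromℕ : ∀ n → NonNeg (fromℕ n)
    nonNeg-fromℕ ℕ.zero    = ≤-refl
    nonNeg-fromℕ (ℕ.suc n) = nonNeg-+ (pos⇒nonNeg pos-1) (nonNeg-fromℕ n)

    fromℕ-suc≉0 : ∀ n → ¬ (fromℕ (ℕ.suc n) ≈ 0#)
    fromℕ-suc≉0 n = pos⇒≉0 (pos-+ pos-1 (nonNeg-fromℕ n))

    pow-cong : ∀ m {u v} → u ≈ v → pow ℝ u m ≈ pow ℝ v m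
    pow-cong ℕ.zero    u≈v = refl
    pow-cong (ℕ.suc m) u≈v = *-cong u≈v (pow-cong m u≈v)

  -- The derivative of a power in the form the product rule gives, which suits the induction in
  -- `pow-quadratic`; `powDeriv-suc` supplies the closed form.
  powDeriv : Carrier → ℕ → Carrier
  powDeriv u ℕ.zero    = 0#
  powDeriv u (ℕ.suc m) = pow ℝ u m + u * powDeriv u m

  opaque
    powDeriv-suc : ∀ u m → powDeriv u (ℕ.suc m) ≈ fromℕ (ℕ.suc m) * pow ℝ u m
    powDeriv-suc u ℕ.zero = solve 1 (λ u → con (ℤ.+ 1) :+ u :* con (ℤ.+ 0) := (con (ℤ.+ 1) :+ con (ℤ.+ 0)) :* con (ℤ.+ 1)) refl u
    powDeriv-suc u (ℕ.suc m) = trans (+-congˡ (*-congˡ (powDeriv-suc u m)))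
      (solve 3 (λ u p n → u :* p :+ u :* ((con (ℤ.+ 1) :+ n) :* p) := (con (ℤ.+ 1) :+ (con (ℤ.+ 1) :+ n)) :* (u :* p)) refl u (pow ℝ u m) (fromℕ m))

  opaque
    pow-quadratic : ∀ m u → ∃ λ C → ∀ h → NonNeg h → NonNeg (1# - h) →
      Within (pow ℝ (u + h) m - pow ℝ u m - powDeriv u m * h) (C * (h * h))
    pow-quadratic ℕ.zero u = 0# , λ h _ _ → within-resp
      (solve 1 (λ h → con (ℤ.+ 0) := con (ℤ.+ 1) :- con (ℤ.+ 1) :- con (ℤ.+ 0) :* h) refl h) (sym (zeroˡ _)) within-0
    pow-quadratic (ℕ.suc m) u with pow-quadratic m u | within-bound u | within-bound (powDeriv u m)
    -- The new error is `u + h` times the old one plus `powDeriv u m * (h * h)`, and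
    -- `|u + h| ≤ A + 1` as `h ≤ 1`.
    ... | C , bound | A , _ , uA | D , _ , dD = (A + 1#) * C + D , λ h 0≤h h≤1 → within-resp
      (solve 5 (λ u h p q d → (u :+ h) :* (q :- p :- d :* h) :+ d :* (h :* h) := (u :+ h) :* q :- u :* p :- (p :+ u :* d) :* h)
        refl u h (pow ℝ u m) (pow ℝ (u + h) m) (powDeriv u m))
      (solve 4 (λ a c d h → (a :+ con (ℤ.+ 1)) :* (c :* (h :* h)) :+ d :* (h :* h) := ((a :+ con (ℤ.+ 1)) :* c :+ d) :* (h :* h)) refl A C D h)
      (within-+ (within-* (within-+ uA (h≤1 , nonNeg-+ (pos⇒nonNeg pos-1) 0≤h)) (bound h 0≤h h≤1))
        (within-* dD (within-nonNeg (*-nonneg 0≤h 0≤h))))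

  opaque
    pow-lipschitz : ∀ m u → ∃ λ C → ∀ h → NonNeg h → NonNeg (1# - h) → Within (pow ℝ (u - h) m - pow ℝ u m) (C * h)
    pow-lipschitz ℕ.zero u = 0# , λ h _ _ → within-resp (sym (-‿inverseʳ 1#)) (sym (zeroˡ _)) within-0
    pow-lipschitz (ℕ.suc m) u with pow-lipschitz m u | within-bound u | within-bound (- pow ℝ u m)
    ... | C , bound | A , _ , uA | D , _ , dD = (A + 1#) * C + D , λ h 0≤h h≤1 → within-resp
      (solve 4 (λ u h p q → (u :+ :- h) :* (q :- p) :+ :- p :* h := (u :- h) :* q :- u :* p) refl u h (pow ℝ u m) (pow ℝ (u - h) m))
      (solve 4 (λ a c d h → (a :+ con (ℤ.+ 1)) :* (c :* h) :+ d :* h := ((a :+ con (ℤ.+ 1)) :* c :+ d) :* h) refl A C D h)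
      (within-+ (within-* (within-+ uA
          ( nonNeg-resp (solve 1 (λ h → con (ℤ.+ 1) :+ h := con (ℤ.+ 1) :- :- h) refl h) (nonNeg-+ (pos⇒nonNeg pos-1) 0≤h) , h≤1))
        (bound h 0≤h h≤1)) (within-* dD (within-nonNeg 0≤h)))

  opaque
    -- At `u = 0` the power is kept, so exponent 0 gives the right-continuous step with value 1 at
    -- its jump. This makes `truncPowDeriv` the right derivative at 0 as well.
    truncPow : ℕ → Carrier → Carrier
    truncPow m u with nonNeg? u
    ... | yes _ = pow ℝ u m
    ... | no _  = 0#

    truncPow-nonNeg : ∀ m {u} → NonNeg u → truncPow m u ≈ pow ℝ u m
    truncPow-nonNeg m {u} 0≤u with nonNeg? u
    ... | yes _   = refl
    ... | no ¬0≤u = contradiction 0≤u ¬0≤u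

    truncPow-neg : ∀ m {u} → ¬ NonNeg u → truncPow m u ≈ 0#
    truncPow-neg m {u} ¬0≤u with nonNeg? u
    ... | yes 0≤u = contradiction 0≤u ¬0≤u
    ... | no _    = refl

  opaque
    truncPow-cong : ∀ m {u v} → u ≈ v → truncPow m u ≈ truncPow m v
    truncPow-cong m {u} {v} u≈v with nonNeg? u
    ... | yes 0≤u = trans (truncPow-nonNeg m 0≤u) (trans (pow-cong m u≈v) (sym (truncPow-nonNeg m (nonNeg-resp u≈v 0≤u))))
    ... | no ¬0≤u = trans (truncPow-neg m ¬0≤u) (sym (truncPow-neg m (λ 0≤v → ¬0≤u (nonNeg-resp (sym u≈v) 0≤v))))

    truncPow-suc-nonPos : ∀ m {u} → u ≤ 0# → truncPow (ℕ.suc m) u ≈ 0#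
    truncPow-suc-nonPos m {u} u≤0 with nonNeg? u
    ... | yes 0≤u = trans (truncPow-nonNeg (ℕ.suc m) 0≤u) (trans (*-congʳ (≤-antisym u≤0 0≤u)) (zeroˡ _))
    ... | no ¬0≤u = truncPow-neg (ℕ.suc m) ¬0≤u

    neg-margin : ∀ {u} → ¬ NonNeg u → ∃ λ δ → Pos δ × (∀ h → NonNeg h → NonNeg (δ - h) → ¬ NonNeg (u + h))
    neg-margin {u} ¬0≤u with small (¬nonNeg⇒pos ¬0≤u) 1#
    ... | δ , pδ , lt = δ , pδ , λ h 0≤h h≤δ → pos⇒¬nonNeg
      (pos-resp (solve 2 (λ u h → :- u :- con (ℤ.+ 1) :* h := :- (u :+ h)) refl u h) (lt h 0≤h h≤δ))

  truncPowDeriv : ℕ → Carrier → Carrier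
  truncPowDeriv ℕ.zero    u = 0#
  truncPowDeriv (ℕ.suc m) u = fromℕ (ℕ.suc m) * truncPow m u

  opaque
    truncPow-rightDeriv : ∀ m u → RightDeriv (truncPow m) u (truncPowDeriv m u)
    truncPow-rightDeriv m u with nonNeg? u
    ... | yes 0≤u = rightDeriv-local {λ v → pow ℝ v m} {truncPow m} 1# pos-1 (sym (truncPow-nonNeg m 0≤u))
            (λ h 0≤h _ → sym (truncPow-nonNeg m (nonNeg-+ 0≤u 0≤h)))
            (rightDeriv-resp {λ v → pow ℝ v m} (deriv m) (1# , pos-1 , pow-quadratic m u))
      where
      deriv : ∀ m → powDeriv u m ≈ truncPowDeriv m u
      deriv ℕ.zero    = refl
      deriv (ℕ.suc m) = trans (powDeriv-suc u m) (*-congˡ (sym (truncPow-nonNeg m 0≤u)))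
    ... | no ¬0≤u with neg-margin ¬0≤u
    ...   | δ , pδ , neg = rightDeriv-local {λ _ → 0#} {truncPow m} δ pδ (sym (truncPow-neg m ¬0≤u))
            (λ h 0≤h h≤δ → sym (truncPow-neg m (neg h 0≤h h≤δ)))
            (rightDeriv-resp {λ _ → 0#} {u} (deriv m) (rightDeriv-zero u))
      where
      deriv : ∀ m → 0# ≈ truncPowDeriv m u
      deriv ℕ.zero    = refl
      deriv (ℕ.suc m) = sym (trans (*-congˡ (truncPow-neg m ¬0≤u)) (zeroʳ _))

    -- A positive exponent closes the gap at 0, where the function joins the zero branch on its
    -- left. For positive `u` the radius is `u` itself, which keeps `u - h` on the power branch.
    truncPow-suc-leftLipschitz : ∀ m u → LeftLipschitz (truncPow (ℕ.suc m)) u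
    truncPow-suc-leftLipschitz m u with u ≤0?
    ... | no pu = leftLipschitz-local {λ v → pow ℝ v (ℕ.suc m)} {truncPow (ℕ.suc m)} u pu (sym (truncPow-nonNeg (ℕ.suc m) (pos⇒nonNeg pu)))
            (λ h _ h≤u → sym (truncPow-nonNeg (ℕ.suc m) h≤u)) (1# , pos-1 , pow-lipschitz (ℕ.suc m) u)
    ... | yes u≤0 = leftLipschitz-local {λ _ → 0#} {truncPow (ℕ.suc m)} 1# pos-1 (sym (truncPow-suc-nonPos m u≤0))
            (λ h 0≤h _ → sym (truncPow-suc-nonPos m (≤-trans (nonNeg⇒≤ (nonNeg-resp (solve 2 (λ u h → h := u :- (u :- h)) refl u h) 0≤h)) u≤0)))
            (leftLipschitz-zero u)

-- Splines and their formal derivatives.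

-- The triple (a , z , e) stands for a (x + z)ᵉ.
module Splines {c ℓ} (ℝ : CompleteOrderedField c ℓ) where
  open TruncatedPowers ℝ public
  open ℕIdentities

  Term : Set c
  Term = Carrier × Carrier × ℕ

  spline : List Term → Carrier → Carrier
  spline []                x = 0#
  spline ((a , z , e) ∷ T) x = a * truncPow e (x + z) + spline T x

  continuousPart : List Term → Carrier → Carrier
  continuousPart []                        x = 0#
  continuousPart ((a , z , ℕ.zero) ∷ T)    x = continuousPart T x
  continuousPart ((a , z , ℕ.suc e) ∷ T)   x = a * truncPow (ℕ.suc e) (x + z) + continuousPart T x

  -- Terms of exponent 0 are deleted instead of getting coefficient 0, so that the drop from
  -- `length T` to `length (derive T)` is the number of jumps.
  derive : List Term → List Term
  derive []                      = []
  derive ((a , z , ℕ.zero) ∷ T)  = derive T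
  derive ((a , z , ℕ.suc e) ∷ T) = (a * fromℕ (ℕ.suc e) , z , e) ∷ derive T

  opaque
    term-cong : ∀ a z e {u v} → u ≈ v → a * truncPow e (u + z) ≈ a * truncPow e (v + z)
    term-cong a z e u≈v = *-congˡ (truncPow-cong e (+-congʳ u≈v))

    spline-cong : ∀ T {u v} → u ≈ v → spline T u ≈ spline T v
    spline-cong []                u≈v = refl
    spline-cong ((a , z , e) ∷ T) u≈v = +-cong (term-cong a z e u≈v) (spline-cong T u≈v)

    term-rightDeriv : ∀ a z e x → RightDeriv (λ x → a * truncPow e (x + z)) x (a * truncPowDeriv e (x + z))
    term-rightDeriv a z e x = rightDeriv-* {λ x → truncPow e (x + z)} a
      (rightDeriv-shift {truncPow e} z (truncPow-cong e) (truncPow-rightDeriv e (x + z)))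

    spline-rightDeriv : ∀ T x → RightDeriv (spline T) x (spline (derive T) x)
    spline-rightDeriv [] x = rightDeriv-zero x
    spline-rightDeriv ((a , z , ℕ.zero) ∷ T) x =
      rightDeriv-resp {spline ((a , z , ℕ.zero) ∷ T)} (trans (+-congʳ (zeroʳ a)) (+-identityˡ _))
        (rightDeriv-+ {λ x → a * truncPow 0 (x + z)} {spline T} (term-rightDeriv a z 0 x) (spline-rightDeriv T x))
    spline-rightDeriv ((a , z , ℕ.suc e) ∷ T) x =
      rightDeriv-resp {spline ((a , z , ℕ.suc e) ∷ T)} (+-congʳ (sym (*-assoc _ _ _)))
        (rightDeriv-+ {λ x → a * truncPow (ℕ.suc e) (x + z)} {spline T} (term-rightDeriv a z (ℕ.suc e) x) (spline-rightDeriv T x))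

    continuousPart-rightDeriv : ∀ T x → RightDeriv (continuousPart T) x (spline (derive T) x)
    continuousPart-rightDeriv [] x = rightDeriv-zero x
    continuousPart-rightDeriv ((a , z , ℕ.zero) ∷ T) x = continuousPart-rightDeriv T x
    continuousPart-rightDeriv ((a , z , ℕ.suc e) ∷ T) x =
      rightDeriv-resp {continuousPart ((a , z , ℕ.suc e) ∷ T)} (+-congʳ (sym (*-assoc _ _ _)))
        (rightDeriv-+ {λ x → a * truncPow (ℕ.suc e) (x + z)} {continuousPart T} (term-rightDeriv a z (ℕ.suc e) x) (continuousPart-rightDeriv T x))

    continuousPart-leftLipschitz : ∀ T x → LeftLipschitz (continuousPart T) x
    continuousPart-leftLipschitz [] x = leftLipschitz-zero x
    continuousPart-leftLipschitz ((a , z , ℕ.zero) ∷ T) x = continuousPart-leftLipschitz T x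
    continuousPart-leftLipschitz ((a , z , ℕ.suc e) ∷ T) x =
      leftLipschitz-+ {λ x → a * truncPow (ℕ.suc e) (x + z)} {continuousPart T}
        (leftLipschitz-* {λ x → truncPow (ℕ.suc e) (x + z)} a
          (leftLipschitz-shift {truncPow (ℕ.suc e)} z (truncPow-cong (ℕ.suc e)) (truncPow-suc-leftLipschitz e (x + z))))
        (continuousPart-leftLipschitz T x)

    continuousPart-cong : ∀ T {u v} → u ≈ v → continuousPart T u ≈ continuousPart T v
    continuousPart-cong []                        u≈v = refl
    continuousPart-cong ((a , z , ℕ.zero) ∷ T)    u≈v = continuousPart-cong T u≈v
    continuousPart-cong ((a , z , ℕ.suc e) ∷ T)   u≈v = +-cong (term-cong a z (ℕ.suc e) u≈v) (continuousPart-cong T u≈v)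

    continuousPart-smooth : ∀ T → Smooth (continuousPart T) (spline (derive T))
    continuousPart-smooth T = record
      { cong          = continuousPart-cong T
      ; rightDeriv    = continuousPart-rightDeriv T
      ; leftLipschitz = continuousPart-leftLipschitz T
      }

  -- Alternating increments and alternating signs.

  -- n disjoint intervals in [a, ∞), from left to right, on which σ g rises, falls, rises, …
  data Increments (g : Carrier → Carrier) : Carrier → Carrier → ℕ → Set (c ⊔ ℓ) where
    done : ∀ {σ a} → Increments g σ a 0
    step : ∀ {σ a n} u v → a ≤ u → u ≤ v → Pos (σ * (g v - g u)) → Increments g (- σ) v n → Increments g σ a (ℕ.suc n)

  -- n points in [a, ∞), from left to right, at which σ g is positive, negative, positive, …
  data Signs (g : Carrier → Carrier) : Carrier → Carrier → ℕ → Set (c ⊔ ℓ) where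
    done : ∀ {σ a} → Signs g σ a 0
    step : ∀ {σ a n} u → a ≤ u → Pos (σ * g u) → Signs g (- σ) u n → Signs g σ a (ℕ.suc n)

  increments-weaken : ∀ {g σ a b n} → b ≤ a → Increments g σ a n → Increments g σ b n
  increments-weaken b≤a done                    = done
  increments-weaken b≤a (step u v a≤u u≤v p is) = step u v (≤-trans b≤a a≤u) u≤v p is

  signs-weaken : ∀ {g σ a b n} → b ≤ a → Signs g σ a n → Signs g σ b n
  signs-weaken b≤a done              = done
  signs-weaken b≤a (step u a≤u p ss) = step u (≤-trans b≤a a≤u) p ss

  increments-resp : ∀ {g σ τ a n} → σ ≈ τ → Increments g σ a n → Increments g τ a n
  increments-resp σ≈τ done                    = done
  increments-resp σ≈τ (step u v a≤u u≤v p is) = step u v a≤u u≤v (pos-resp (*-congʳ σ≈τ) p) (increments-resp (-‿cong σ≈τ) is)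

  increments-map : ∀ {f g σ a n} → (∀ u v → a ≤ u → u ≤ v → f v - f u ≈ g v - g u) → Increments f σ a n → Increments g σ a n
  increments-map f≈g done = done
  increments-map f≈g (step u v a≤u u≤v p is) = step u v a≤u u≤v (pos-resp (*-congˡ (f≈g u v a≤u u≤v)) p)
    (increments-map (λ u′ v′ v≤u′ → f≈g u′ v′ (≤-trans (≤-trans a≤u u≤v) v≤u′)) is)

  increments-cong : ∀ {f g σ a n} → (∀ u → f u ≈ g u) → Increments f σ a n → Increments g σ a n
  increments-cong f≈g = increments-map (λ u v _ _ → +-cong (f≈g v) (-‿cong (f≈g u)))

  -- The jump lies in at most one of the intervals; dropping that interval and the next one keeps the signs alternating.
  increments-remove-jump : ∀ {f g σ a n} b z → (∀ u → f u ≈ b * truncPow 0 (u + z) + g u) →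
    Increments f σ a n → ∃ λ m → n ≤ℕ m ℕ.+ 2 × Increments g σ a m
  increments-remove-jump b z f≈ done = 0 , ℕ.z≤n , done
  increments-remove-jump {f} {g} {σ} b z f≈ (step {n = n} u v a≤u u≤v p is) = cases (nonNeg? (u + z)) (nonNeg? (v + z))
    where
    shift : ∀ {x y} → x ≤ y → NonNeg (x + z) → NonNeg (y + z)
    shift {x} {y} x≤y 0≤x+z = nonNeg-resp (solve 3 (λ x y z → (x :+ z) :+ (y :- x) := y :+ z) refl x y z) (nonNeg-+ 0≤x+z (≤⇒nonNeg x≤y))
    same : ∀ {x y} → truncPow 0 (x + z) ≈ truncPow 0 (y + z) → f y - f x ≈ g y - g x
    same {x} {y} eq = trans (+-cong (f≈ y) (-‿cong (trans (f≈ x) (+-congʳ (*-congˡ eq)))))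
      (solve 3 (λ t gx gy → t :+ gy :- (t :+ gx) := gy :- gx) refl (b * truncPow 0 (y + z)) (g x) (g y))
    right : ∀ {w} → NonNeg (w + z) → ∀ x y → w ≤ x → x ≤ y → f y - f x ≈ g y - g x
    right 0≤w+z x y w≤x x≤y = same (trans (truncPow-nonNeg 0 (shift w≤x 0≤w+z)) (sym (truncPow-nonNeg 0 (shift (≤-trans w≤x x≤y) 0≤w+z))))
    drop-next : ∀ {m} → NonNeg (v + z) → Increments f (- σ) v m → ∃ λ k → ℕ.suc m ≤ℕ k ℕ.+ 2 × Increments g σ _ k
    drop-next 0≤v+z done = 0 , ℕ.s≤s ℕ.z≤n , done
    drop-next 0≤v+z (step {n = k} u′ v′ v≤u′ u′≤v′ _ is′) = k , ℕ.≤-reflexive (ℕ.+-comm 2 k) ,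
      increments-weaken (≤-trans a≤u (≤-trans u≤v (≤-trans v≤u′ u′≤v′)))
        (increments-resp (solve 1 (λ s → :- :- s := s) refl σ) (increments-map (right (shift (≤-trans v≤u′ u′≤v′) 0≤v+z)) is′))
    -- The jump at `- z` lies at or before `u`, in `(u, v]`, or beyond `v`; only in the last case
    -- does the search go on.
    cases : Dec (NonNeg (u + z)) → Dec (NonNeg (v + z)) → ∃ λ m → ℕ.suc n ≤ℕ m ℕ.+ 2 × Increments g σ _ m
    cases (yes 0≤u+z) _ = ℕ.suc n , ℕ.m≤m+n _ 2 , increments-weaken a≤u (increments-map (right 0≤u+z) (step u v ≤-refl u≤v p is))
    cases (no _) (yes 0≤v+z) = drop-next 0≤v+z is
    cases (no ¬0≤u+z) (no ¬0≤v+z) with increments-remove-jump b z f≈ is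
    ... | m , n≤m+2 , is′ = ℕ.suc m , ℕ.s≤s n≤m+2 ,
      step u v a≤u u≤v (pos-resp (*-congˡ (same (trans (truncPow-neg 0 ¬0≤u+z) (sym (truncPow-neg 0 ¬0≤v+z))))) p) is′

  -- Each jump costs at most two increments; their number, `length T` minus `length (derive T)`, is
  -- written without subtraction. The function `r` collects the continuous terms already passed, so
  -- that the whole sum stays in view along the induction.
  increments-continuousPart : ∀ T r {σ a n} → Increments (λ x → r x + spline T x) σ a n →
    ∃ λ m → n ℕ.+ 2 ℕ.* length (derive T) ≤ℕ m ℕ.+ 2 ℕ.* length T × Increments (λ x → r x + continuousPart T x) σ a m
  increments-continuousPart [] r {n = n} is = n , ℕ.≤-refl , is
  increments-continuousPart ((b , z , ℕ.zero) ∷ T) r {n = n} is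
    with increments-remove-jump {g = λ x → r x + spline T x} b z
      (λ u → solve 3 (λ r t s → r :+ (t :+ s) := t :+ (r :+ s)) refl (r u) (b * truncPow 0 (u + z)) (spline T u)) is
  ... | m , n≤m+2 , is′ with increments-continuousPart T r is′
  ...   | k , m≤k , is″ = k , bound , is″
    where
    open ℕ.≤-Reasoning
    bound : n ℕ.+ 2 ℕ.* length (derive T) ≤ℕ k ℕ.+ 2 ℕ.* ℕ.suc (length T)
    bound = begin
      n ℕ.+ 2 ℕ.* length (derive T)            ≤⟨ ℕ.+-monoˡ-≤ _ n≤m+2 ⟩
      m ℕ.+ 2 ℕ.+ 2 ℕ.* length (derive T)      ≡⟨ +-2-move m _ ⟩
      2 ℕ.+ (m ℕ.+ 2 ℕ.* length (derive T))    ≤⟨ ℕ.+-monoʳ-≤ 2 m≤k ⟩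
      2 ℕ.+ (k ℕ.+ 2 ℕ.* length T)             ≡⟨ +-2*suc k _ ⟨
      k ℕ.+ 2 ℕ.* ℕ.suc (length T)             ∎
  increments-continuousPart ((b , z , ℕ.suc e) ∷ T) r {n = n} is
    with increments-continuousPart T (λ x → r x + b * truncPow (ℕ.suc e) (x + z)) (increments-cong (λ u → sym (+-assoc _ _ _)) is)
  ... | m , n≤m , is′ = m , bound , increments-cong (λ u → +-assoc _ _ _) is′
    where
    open ℕ.≤-Reasoning
    bound : n ℕ.+ 2 ℕ.* ℕ.suc (length (derive T)) ≤ℕ m ℕ.+ 2 ℕ.* ℕ.suc (length T)
    bound = begin
      n ℕ.+ 2 ℕ.* ℕ.suc (length (derive T))    ≡⟨ +-2*suc n _ ⟩
      2 ℕ.+ (n ℕ.+ 2 ℕ.* length (derive T))    ≤⟨ ℕ.+-monoʳ-≤ 2 n≤m ⟩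
      2 ℕ.+ (m ℕ.+ 2 ℕ.* length T)             ≡⟨ +-2*suc m _ ⟨
      m ℕ.+ 2 ℕ.* ℕ.suc (length T)             ∎

  -- Each interval contributes one point; the mean value theorem is applied to `σ * g`, so that
  -- falls count as rises.
  increments⇒signs : ∀ {g g′ σ a n} → Smooth g g′ → Increments g σ a n → Signs g′ σ a n
  increments⇒signs smooth done = done
  increments⇒signs {g} {g′} {σ} smooth (step u v a≤u u≤v p is)
    with mean-value (smooth-* σ smooth) u≤v (pos-resp (solve 3 (λ s x y → s :* (y :- x) := s :* y :- s :* x) refl σ (g u) (g v)) p)
  ... | s , u≤s , s≤v , ps = step s (≤-trans a≤u u≤s) ps (signs-weaken s≤v (increments⇒signs smooth is))

  VanishesLeft VanishesRight : (Carrier → Carrier) → Set (c ⊔ ℓ)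
  VanishesLeft g = ∃ λ A → ∀ x → x ≤ A → g x ≈ 0#
  VanishesRight g = ∃ λ B → ∀ x → B ≤ x → g x ≈ 0#

  -- Rolle for a compactly supported function.
  signs⇒increments : ∀ {g σ a n} → VanishesLeft g → VanishesRight g → Signs g σ a (ℕ.suc n) → ∃ λ b → Increments g σ b (ℕ.suc (ℕ.suc n))
  signs⇒increments {g} {σ} (A , left) (B , right) (step u _ p ss) with lower-bound A u
  -- Consecutive points among the `n + 1` give `n` increments. The two extra ones lead from zero at
  -- `b` to the first point and from the last point back to zero.
  ... | b , b≤A , b≤u = b , step b u ≤-refl b≤u
      (pos-resp (*-congˡ (trans (solve 1 (λ x → x := x :- con (ℤ.+ 0)) refl (g u)) (+-congˡ (-‿cong (sym (left b b≤A)))))) p)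
      (tail p ss)
    where
    tail : ∀ {σ u n} → Pos (σ * g u) → Signs g (- σ) u n → Increments g (- σ) u (ℕ.suc n)
    tail {σ} {u} p done with upper-bound B u
    ... | w , B≤w , u≤w = step u w ≤-refl u≤w
      (pos-resp (trans (solve 2 (λ s x → s :* x := :- s :* (con (ℤ.+ 0) :- x)) refl σ (g u)) (*-congˡ (+-congʳ (sym (right w B≤w))))) p) done
    tail {σ} {u} p (step w u≤w q ss) = step u w ≤-refl u≤w
      (pos-resp (solve 3 (λ s x y → :- s :* y :+ s :* x := :- s :* (y :- x)) refl σ (g u) (g w)) (pos-+ q (pos⇒nonNeg p)))
      (tail q ss)

  -- Any scalar may serve as `σ`; with `σ = g x` the product is a square, and the sign of `g x` need
  -- not be known.
  nonzero⇒signs : ∀ {g x} → ¬ (g x ≈ 0#) → Signs g (g x) x 1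
  nonzero⇒signs gx≉0 = step _ ≤-refl (pos-square gx≉0) done

  -- Compact support, and a term that cannot cancel.

  spline-vanishesLeft : ∀ T → VanishesLeft (spline T)
  spline-vanishesLeft [] = 0# , λ _ _ → refl
  spline-vanishesLeft ((b , z , e) ∷ T) with spline-vanishesLeft T
  -- The 1 keeps `x + z` strictly negative, as a step already has value 1 at its knot.
  ... | A , left with lower-bound A (- (z + 1#))
  ...   | A′ , A′≤A , A′≤ = A′ , λ x x≤A′ → trans
    (+-cong (trans (*-congˡ (truncPow-neg e (λ 0≤x+z → pos-1 (nonNeg⇒≤0 (nonNeg-resp
      (solve 2 (λ x z → :- (z :+ con (ℤ.+ 1)) :- x :+ (x :+ z) := :- con (ℤ.+ 1)) refl x z)
      (nonNeg-+ (≤⇒nonNeg (≤-trans x≤A′ A′≤)) 0≤x+z)))))) (zeroʳ b)) (left x (≤-trans x≤A′ A′≤A)))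
    (+-identityˡ 0#)

  derive-vanishesRight : ∀ T → VanishesRight (spline T) → VanishesRight (spline (derive T))
  derive-vanishesRight T (B , right) = B , λ x B≤x → zero-deriv x B≤x (spline (derive T) x ≈0?)
    where
    zero-deriv : ∀ x → B ≤ x → Dec (spline (derive T) x ≈ 0#) → spline (derive T) x ≈ 0#
    zero-deriv x B≤x (yes p) = p
    zero-deriv x B≤x (no ¬p) with nonzero-deriv⇒nonzero {spline T} (spline-rightDeriv T x) ¬p
    ... | w , x≤w , ≉0 = contradiction (right w (≤-trans B≤x x≤w)) ≉0

  -- A knot `- z′` to the left of `- z` limits `δ` to the distance `- z + z′`; a knot to the right
  -- is never reached.
  spline-locally-constant : ∀ z T → All (λ (_ , z′ , e) → e ≡ 0 × ¬ (z′ ≈ z)) T →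
    ∃ λ δ → Pos δ × (∀ h → NonNeg h → NonNeg (δ - h) → spline T (- z - h) ≈ spline T (- z))
  spline-locally-constant z [] [] = 1# , pos-1 , λ _ _ _ → refl
  spline-locally-constant z ((b , z′ , _) ∷ T) ((≡.refl , z′≉z) ∷ all) with spline-locally-constant z T all
  ... | δ , pδ , const with (- z + z′) ≤0?
  ...   | no p with pos-min pδ p
  ...     | ε , pε , ε≤δ , ε≤ = ε , pε , λ h 0≤h h≤ε → +-cong
    (*-congˡ (trans (truncPow-nonNeg 0 (nonNeg-resp (solve 3 (λ z y h → :- z :+ y :- h := :- z :- h :+ y) refl z z′ h) (≤-nonNeg-trans ε≤ h≤ε)))
      (sym (truncPow-nonNeg 0 (pos⇒nonNeg p)))))
    (const h 0≤h (≤-nonNeg-trans ε≤δ h≤ε))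
  spline-locally-constant z ((b , z′ , _) ∷ T) ((≡.refl , z′≉z) ∷ all) | δ , pδ , const | yes z′-z≤0 =
    δ , pδ , λ h 0≤h h≤δ → +-cong (*-congˡ (trans (truncPow-neg 0 (before h 0≤h)) (sym (truncPow-neg 0 at)))) (const h 0≤h h≤δ)
    where
    at : ¬ NonNeg (- z + z′)
    at 0≤z′-z = z′≉z (trans (solve 2 (λ z y → y := (:- z :+ y) :+ z) refl z z′) (trans (+-congʳ (≤-antisym z′-z≤0 0≤z′-z)) (+-identityˡ z)))
    before : ∀ h → NonNeg h → ¬ NonNeg (- z - h + z′)
    before h 0≤h 0≤ = at (nonNeg-resp (solve 3 (λ z y h → :- z :- h :+ y :+ h := :- z :+ y) refl z z′ h) (nonNeg-+ 0≤ 0≤h))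

  -- The invariant carried through the derivatives. Shifts are compared at exponent `d` only, since
  -- all smaller exponents are gone after `d` derivations.
  record Dominant (d : ℕ) (a z : Carrier) (T : List Term) : Set (c ⊔ ℓ) where
    constructor dominant
    field
      nonzero : ¬ (a ≈ 0#)
      rest    : All (λ (_ , z′ , e) → e ≤ℕ d × (e ≡ d → ¬ (z′ ≈ z))) T

  dominant-derive : ∀ {d a z T} → Dominant (ℕ.suc d) a z T → Dominant d (a * fromℕ (ℕ.suc d)) z (derive T)
  dominant-derive {d} {a} {z} (dominant a≉0 rest) =
    dominant (λ eq → fromℕ-suc≉0 d (*-cancel-≈0 a≉0 eq)) (derive-rest rest)
    where
    derive-rest : ∀ {T} → All (λ (_ , z′ , e) → e ≤ℕ ℕ.suc d × (e ≡ ℕ.suc d → ¬ (z′ ≈ z))) T →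
      All (λ (_ , z′ , e) → e ≤ℕ d × (e ≡ d → ¬ (z′ ≈ z))) (derive T)
    derive-rest [] = []
    derive-rest {(_ , _ , ℕ.zero) ∷ _}  (_ ∷ all)                 = derive-rest all
    derive-rest {(_ , _ , ℕ.suc e) ∷ _} ((ℕ.s≤s e≤d , p) ∷ all) = (e≤d , λ e≡d → p (≡.cong ℕ.suc e≡d)) ∷ derive-rest all

  -- After `d` derivations only steps are left, and the leading one alone jumps at `- z`, by a
  -- nonzero amount; the values at `- z` and just before it cannot both vanish. A nonzero derivative
  -- then forces a nonzero function, level by level.
  dominant⇒nonzero : ∀ d {a z T} → Dominant d a z T → ∃ λ x → ¬ (spline ((a , z , d) ∷ T) x ≈ 0#)
  dominant⇒nonzero ℕ.zero {a} {z} {T} (dominant a≉0 rest)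
    with spline-locally-constant z T (All.map (λ where (ℕ.z≤n , p) → ≡.refl , p ≡.refl) rest)
  ... | δ , pδ , const with spline ((a , z , 0) ∷ T) (- z) ≈0?
  ...   | no ≉0 = - z , ≉0
  ...   | yes ≈0 = - z - δ , λ ≈0′ → a≉0 (jump ≈0′)
    where
    open SetoidReasoning setoid
    jump : spline ((a , z , 0) ∷ T) (- z - δ) ≈ 0# → a ≈ 0#
    jump ≈0′ = begin
      a                                                                     ≈⟨ solve 2 (λ a s → a := a :* con (ℤ.+ 1) :+ s :- (a :* con (ℤ.+ 0) :+ s)) refl a (spline T (- z)) ⟩
      a * 1# + spline T (- z) - (a * 0# + spline T (- z))
        ≈⟨ +-cong (+-congʳ (*-congˡ (sym at)))
             (-‿cong (+-cong (*-congˡ (sym before)) (sym (const δ (pos⇒nonNeg pδ) (≤⇒nonNeg ≤-refl))))) ⟩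
      spline ((a , z , 0) ∷ T) (- z) - spline ((a , z , 0) ∷ T) (- z - δ)   ≈⟨ +-cong ≈0 (-‿cong ≈0′) ⟩
      0# - 0#                                                               ≈⟨ -‿inverseʳ 0# ⟩
      0#                                                                    ∎
      where
      at : truncPow 0 (- z + z) ≈ 1#
      at = truncPow-nonNeg 0 (≤-resp-≈ refl (sym (-‿inverseˡ z)) ≤-refl)
      before : truncPow 0 (- z - δ + z) ≈ 0#
      before = truncPow-neg 0 (pos⇒¬nonNeg (pos-resp (solve 2 (λ z d → d := :- (:- z :- d :+ z)) refl z δ) pδ))
  dominant⇒nonzero (ℕ.suc d) {a} {z} {T} dom with dominant⇒nonzero d (dominant-derive dom)
  ... | x , ≉0 with nonzero-deriv⇒nonzero {spline ((a , z , ℕ.suc d) ∷ T)} (spline-rightDeriv ((a , z , ℕ.suc d) ∷ T) x) ≉0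
  ...   | w , _ , w≉0 = w , w≉0

  continuousPart-constant : ∀ T → All (λ (_ , _ , e) → e ≡ 0) T → ∀ x → continuousPart T x ≈ 0#
  continuousPart-constant [] [] x = refl
  continuousPart-constant ((_ , _ , ℕ.zero) ∷ T) (_ ∷ all) x = continuousPart-constant T all x

  -- The telescoped count, by induction on `d`: jumps are paid for by the decrease of the list, and
  -- each derivation gains one increment.
  dominant-increments : ∀ d {a z T} → Dominant d a z T → VanishesRight (spline ((a , z , d) ∷ T)) →
    ∀ {σ b n} → Increments (spline ((a , z , d) ∷ T)) σ b n → n ℕ.+ d ≤ℕ 2 ℕ.* ℕ.suc (length T)
  dominant-increments d {a} {z} {T} dom right {σ} {b} {n} is
    with increments-continuousPart ((a , z , d) ∷ T) (λ _ → 0#) (increments-cong (λ x → sym (+-identityˡ _)) is)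
  dominant-increments ℕ.zero {a} {z} {T} dom right {n = n} is | ℕ.zero , bound , _ =
    ℕ.≤-trans (ℕ.+-monoʳ-≤ n ℕ.z≤n) bound
  -- All exponents are 0, so the continuous part is zero and no increment can survive.
  dominant-increments ℕ.zero {a} {z} {T} dom right {n = n} is | ℕ.suc m , bound , step {σ = σ} u v _ _ p _ =
    contradiction (*-congˡ (trans (+-cong (zero-at v) (-‿cong (zero-at u))) (-‿inverseʳ 0#)))
      (λ eq → pos⇒≉0 p (trans eq (zeroʳ σ)))
    where
    zero-at : ∀ x → 0# + continuousPart T x ≈ 0#
    zero-at x = trans (+-identityˡ _) (continuousPart-constant T (All.map (λ (e≤0 , _) → ℕ.n≤0⇒n≡0 e≤0) (Dominant.rest dom)) x)
  dominant-increments (ℕ.suc d) {a} {z} {T} dom right {σ} {b} {n} is | m , bound , is′ =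
    conclude m bound (increments⇒signs (continuousPart-smooth S) (increments-cong (λ x → +-identityˡ _) is′))
    where
    S = (a , z , ℕ.suc d) ∷ T
    L L′ : ℕ
    L = ℕ.suc (length T)
    L′ = ℕ.suc (length (derive T))
    derived : ∀ {τ b k} → Signs (spline (derive S)) τ b (ℕ.suc k) → ℕ.suc (ℕ.suc k) ℕ.+ d ≤ℕ 2 ℕ.* L′
    derived ss = dominant-increments d (dominant-derive dom) (derive-vanishesRight S right)
      (proj₂ (signs⇒increments (spline-vanishesLeft (derive S)) (derive-vanishesRight S right) ss))
    combine : ∀ k → n ℕ.+ 2 ℕ.* L′ ≤ℕ k ℕ.+ 2 ℕ.* L → ℕ.suc k ℕ.+ d ≤ℕ 2 ℕ.* L′ → n ℕ.+ ℕ.suc d ≤ℕ 2 ℕ.* L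
    combine k p q = ℕ.+-cancelʳ-≤ (k ℕ.+ 2 ℕ.* L′) _ _ (begin
      n ℕ.+ ℕ.suc d ℕ.+ (k ℕ.+ 2 ℕ.* L′)          ≡⟨ exchange n d k _ ⟩
      (n ℕ.+ 2 ℕ.* L′) ℕ.+ (ℕ.suc k ℕ.+ d)        ≤⟨ ℕ.+-mono-≤ p q ⟩
      (k ℕ.+ 2 ℕ.* L) ℕ.+ 2 ℕ.* L′                ≡⟨ rotate k _ _ ⟩
      2 ℕ.* L ℕ.+ (k ℕ.+ 2 ℕ.* L′)                ∎)
      where open ℕ.≤-Reasoning
    conclude : ∀ m → n ℕ.+ 2 ℕ.* L′ ≤ℕ m ℕ.+ 2 ℕ.* L → ∀ {τ b} → Signs (spline (derive S)) τ b m → n ℕ.+ ℕ.suc d ≤ℕ 2 ℕ.* L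
    conclude (ℕ.suc m) bound ss = combine (ℕ.suc m) bound (derived ss)
    -- With no increment left there is no sign to pass on. A nonzero value of the derivative
    -- supplies one, which yields `2 + d ≤ 2 * L′` where `1 + d` is enough.
    conclude ℕ.zero    bound _  = combine 0 bound (ℕ.≤-trans (ℕ.n≤1+n _)
      (derived (nonzero⇒signs {spline (derive S)} (proj₂ (dominant⇒nonzero d (dominant-derive dom))))))

  dominant-length : ∀ d {a z T} → Dominant d a z T → VanishesRight (spline ((a , z , d) ∷ T)) → 2 ℕ.+ d ≤ℕ 2 ℕ.* ℕ.suc (length T)
  dominant-length d {a} {z} {T} dom right = dominant-increments d dom right
    (proj₂ (signs⇒increments (spline-vanishesLeft S) right (nonzero⇒signs {spline S} (proj₂ (dominant⇒nonzero d dom)))))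
    where S = (a , z , d) ∷ T

-- From the polynomial identity to the bound.

module Representation {c ℓ} (ℝ : CompleteOrderedField c ℓ) where
  open Splines ℝ public
  open ℕIdentities

  polynomial : List Term → Carrier → Carrier
  polynomial []                x = 0#
  polynomial ((a , z , e) ∷ T) x = a * pow ℝ (x + z) e + polynomial T x

  spline-eventually-polynomial : ∀ T → ∃ λ B → ∀ x → B ≤ x → spline T x ≈ polynomial T x
  spline-eventually-polynomial [] = 0# , λ _ _ → refl
  spline-eventually-polynomial ((a , z , e) ∷ T) with spline-eventually-polynomial T
  ... | B , eq with upper-bound B (- z)
  ...   | B′ , B≤B′ , -z≤B′ = B′ , λ x B′≤x → +-cong
    (*-congˡ (truncPow-nonNeg e (nonNeg-resp (solve 2 (λ x z → x :- :- z := x :+ z) refl x z) (≤⇒nonNeg (≤-trans -z≤B′ B′≤x)))))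
    (eq x (≤-trans B≤B′ B′≤x))

  polynomial-++ : ∀ S T x → polynomial (S ++ T) x ≈ polynomial S x + polynomial T x
  polynomial-++ []                T x = sym (+-identityˡ _)
  polynomial-++ ((a , z , e) ∷ S) T x = trans (+-congˡ (polynomial-++ S T x)) (sym (+-assoc _ _ _))

  polynomial-tabulate : ∀ n (a z : Fin n → Carrier) (e : Fin n → ℕ) x →
    polynomial (tabulate (λ i → a i , z i , e i)) x ≈ ∑ ℝ n (λ i → a i * pow ℝ (x + z i) (e i))
  polynomial-tabulate ℕ.zero    a z e x = refl
  polynomial-tabulate (ℕ.suc n) a z e x = +-congˡ (polynomial-tabulate n _ _ _ x)

  ∑-neg : ∀ n (f g : Fin n → Carrier) → (∀ i → f i ≈ - g i) → ∑ ℝ n f ≈ - ∑ ℝ n g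
  ∑-neg ℕ.zero    f g f≈-g = solve 0 (con (ℤ.+ 0) := :- con (ℤ.+ 0)) refl
  ∑-neg (ℕ.suc n) f g f≈-g = trans (+-cong (f≈-g Fin.zero) (∑-neg n _ _ (λ i → f≈-g (Fin.suc i))))
    (solve 2 (λ a b → :- a :+ :- b := :- (a :+ b)) refl _ _)

  ∑-punchIn : ∀ n (i : Fin (ℕ.suc n)) f → ∑ ℝ (ℕ.suc n) f ≈ f i + ∑ ℝ n (λ j → f (Fin.punchIn i j))
  ∑-punchIn n         Fin.zero    f = refl
  ∑-punchIn (ℕ.suc n) (Fin.suc i) f = trans (+-congˡ (∑-punchIn n i (λ j → f (Fin.suc j))))
    (solve 3 (λ a b s → a :+ (b :+ s) := b :+ (a :+ s)) refl _ _ _)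

  -- Pigeonhole: if every `xs i` equalled some `ys j`, choosing such a `j` would be injective
  -- because the `xs` are distinct, and `k ≤ l` would follow.
  unmatched : ∀ {k l} (xs : Fin k → Carrier) (ys : Fin l → Carrier) → (∀ i j → xs i ≈ xs j → i ≡ j) → ¬ (k ≤ℕ l) →
    ∃ λ i → ∀ j → ¬ (ys j ≈ xs i)
  unmatched {k} {l} xs ys distinct k≰l with Fin.any? (λ i → Fin.all? (λ j → ¬? (ys j ≟ xs i)))
  ... | yes (i , p) = i , p
  ... | no none = contradiction (Fin.injective⇒≤ {f = λ i → proj₁ (match i)} matched) k≰l
    where
    match : ∀ i → ∃ λ j → ys j ≈ xs i
    match i with Fin.any? (λ j → ys j ≟ xs i)
    ... | yes p = p
    ... | no p  = contradiction (i , λ j y≈x → p (j , y≈x)) none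
    matched : ∀ {i j} → proj₁ (match i) ≡ proj₁ (match j) → i ≡ j
    matched {i} {j} eq = distinct i j (trans (sym (proj₂ (match i))) (trans (reflexive (≡.cong ys eq)) (proj₂ (match j))))

  lower-bound-of-length : (d k : ℕ) (xs α : Fin k → Carrier) →
    (∀ i j → xs i ≈ xs j → i ≡ j) → (∀ i → ¬ (α i ≈ 0#)) → 4 ℕ.* k ≤ℕ d ℕ.+ 2 →
    (l : ℕ) (β ys : Fin l → Carrier) (e : Fin l → ℕ) → (∀ i → e i ≤ℕ d) →
    (∀ x → ∑ ℝ k (λ i → α i * pow ℝ (x + xs i) d) ≈ ∑ ℝ l (λ i → β i * pow ℝ (x + ys i) (e i))) →
    ¬ ¬ (k ≤ℕ l)
  lower-bound-of-length d ℕ.zero xs α _ _ _ l β ys e _ _ k≰l = k≰l ℕ.z≤n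
  lower-bound-of-length d (ℕ.suc k) xs α distinct α≉0 4k≤d+2 l β ys e e≤d eq k≰l with unmatched xs ys distinct k≰l
  ... | i , ys≉xsᵢ = ℕ.<-irrefl ≡.refl (ℕ.≤-trans too-long (ℕ.≤-trans 4k≤d+2 (ℕ.≤-reflexive (ℕ.+-comm d 2))))
    where
    otherTerm : Fin k → Term
    otherTerm j = α (Fin.punchIn i j) , xs (Fin.punchIn i j) , d
    negatedTerm : Fin l → Term
    negatedTerm j = - β j , ys j , e j
    S S′ : List Term
    S = tabulate otherTerm
    S′ = tabulate negatedTerm

    isDominant : Dominant d (α i) (xs i) (S ++ S′)
    isDominant = dominant (α≉0 i) (All.++⁺
      (All.tabulate⁺ (λ j → ℕ.≤-refl , λ _ x≈x → Fin.punchInᵢ≢i i j (distinct _ _ x≈x)))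
      (All.tabulate⁺ (λ j → e≤d j , λ _ → ys≉xsᵢ j)))

    vanishes : ∀ x → polynomial ((α i , xs i , d) ∷ S ++ S′) x ≈ 0#
    vanishes x = begin
      α i * pow ℝ (x + xs i) d + polynomial (S ++ S′) x
        ≈⟨ +-congˡ (polynomial-++ S S′ x) ⟩
      α i * pow ℝ (x + xs i) d + (polynomial S x + polynomial S′ x)
        ≈⟨ +-assoc _ _ _ ⟨
      α i * pow ℝ (x + xs i) d + polynomial S x + polynomial S′ x
        ≈⟨ +-cong (+-congˡ (polynomial-tabulate k _ _ _ x)) (polynomial-tabulate l _ _ _ x) ⟩
      α i * pow ℝ (x + xs i) d + ∑ ℝ k (λ j → α (Fin.punchIn i j) * pow ℝ (x + xs (Fin.punchIn i j)) d)
        + ∑ ℝ l (λ j → - β j * pow ℝ (x + ys j) (e j))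
        ≈⟨ +-cong (sym (∑-punchIn k i (λ j → α j * pow ℝ (x + xs j) d))) (∑-neg l _ _ (λ j → solve 2 (λ b p → :- b :* p := :- (b :* p)) refl (β j) (pow ℝ (x + ys j) (e j)))) ⟩
      ∑ ℝ (ℕ.suc k) (λ j → α j * pow ℝ (x + xs j) d) - ∑ ℝ l (λ j → β j * pow ℝ (x + ys j) (e j))
        ≈⟨ +-congʳ (eq x) ⟩
      ∑ ℝ l (λ j → β j * pow ℝ (x + ys j) (e j)) - ∑ ℝ l (λ j → β j * pow ℝ (x + ys j) (e j))
        ≈⟨ -‿inverseʳ _ ⟩
      0# ∎
      where open SetoidReasoning setoid

    vanishesRight : VanishesRight (spline ((α i , xs i , d) ∷ S ++ S′))
    vanishesRight with spline-eventually-polynomial ((α i , xs i , d) ∷ S ++ S′)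
    ... | B , agree = B , λ x B≤x → trans (agree x B≤x) (vanishes x)

    -- The theorem's `k` is `suc k` here, so `l ≤ k` and there are at most `2k + 1` terms. Hence
    -- `2 + d ≤ 4k + 2`, which leaves room for the strict inequality against `4k + 4`.
    too-long : ℕ.suc (2 ℕ.+ d) ≤ℕ 4 ℕ.* ℕ.suc k
    too-long = begin
      ℕ.suc (2 ℕ.+ d)                        ≤⟨ ℕ.s≤s (dominant-length d isDominant vanishesRight) ⟩
      ℕ.suc (2 ℕ.* ℕ.suc (length (S ++ S′))) ≡⟨ ≡.cong (λ n → ℕ.suc (2 ℕ.* ℕ.suc n))
        (≡.trans (List.length-++ S) (≡.cong₂ ℕ._+_ (List.length-tabulate otherTerm) (List.length-tabulate negatedTerm))) ⟩
      ℕ.suc (2 ℕ.* ℕ.suc (k ℕ.+ l))          ≤⟨ ℕ.s≤s (ℕ.*-monoʳ-≤ 2 (ℕ.s≤s (ℕ.+-monoʳ-≤ k (ℕ.≤-pred (ℕ.≰⇒> k≰l))))) ⟩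
      ℕ.suc (2 ℕ.* ℕ.suc (k ℕ.+ k))          ≤⟨ ℕ.n≤1+n _ ⟩
      ℕ.suc (ℕ.suc (2 ℕ.* ℕ.suc (k ℕ.+ k)))  ≡⟨ 2+2*suc-double k ⟩
      4 ℕ.* ℕ.suc k                          ∎
      where open ℕ.≤-Reasoning

theorem14 : ∀ {c ℓ} (ℝ : CompleteOrderedField c ℓ) →
    let open CompleteOrderedField ℝ in
    (d k : ℕ) (xs α : Fin k → Carrier) →
    (∀ i j → xs i ≈ xs j → i ≡ j) →
    (∀ i → ¬ (α i ≈ 0#)) →
    4 *ℕ k ≤ℕ d +ℕ 2 →
    (l : ℕ) (β ys : Fin l → Carrier) (e : Fin l → ℕ) →
    (∀ i → e i ≤ℕ d) →
    (∀ x → ∑ ℝ k (λ i → α i * pow ℝ (x + xs i) d)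
    ≈ ∑ ℝ l (λ i → β i * pow ℝ (x + ys i) (e i))) →
    k ≤ℕ l
theorem14 ℝ d k xs α distinct α≉0 4k≤d+2 l β ys e e≤d eq =
  decidable-stable (k ℕ.≤? l) (Representation.lower-bound-of-length ℝ d k xs α distinct α≉0 4k≤d+2 l β ys e e≤d eq)
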